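{- (Undirected case.) Let $G$ be a connected weighted simple graph on $n$ vertices. Then the generating function $f_G$ for spanning trees in $G$ can be computed by a subtraction-free arithmetic circuit of size $O(n^3)$. (Directed case.) Let $G$ be a weighted simple directed graph on $n$ vertices with a given vertex $r$ such that there is a directed path from every vertex to $r$. Then the generating function $\varphi_G$ for directed spanning trees in $G$ rooted at $r$ can be computed by a subtraction-free arithmetic circuit of size $O(n^3)$. The implied constants are absolute.
   Context: Subtraction-free circuits: an arithmetic circuit is a directed acyclic network whose gates each perform one binary arithmetic operation; its inputs are the variables and arbitrary positive integer scalars, and it outputs a rational function in the variables. It is subtraction-free if every gate is an addition, a multiplication or a division (no subtraction gates, no negative scalars). The size of a circuit is its number of gates. Graphs: a simple graph has no loops and no multiple edges. A simple directed graph has no loops and no two edges with the same source and the same target (opposite edges $a\to b$ and $b\to a$ are allowed). "Weighted" means that a formal variable $x_e$ is attached to each edge $e$ (distinct variables for distinct edges). Undirected generating function: $f_G=\sum_T x^T$, the sum over all spanning trees $T$ of $G$, where $x^T$ is the product of $x_e$ over the edges $e$ of $T$. Directed generating function: a directed spanning tree rooted at $r$ is a subgraph $T$ of $G$ containing all vertices which is a spanning tree (ignoring orientations) with all edges oriented towards $r$; equivalently, for every vertex $v$ there is a unique path in $T$ from $v$ to $r$. Then $\varphi_G=\sum_T x^T$, the sum over all directed spanning trees $T$ of $G$ rooted at $r$, with $x^T$ the product of $x_e$ over the edges $e$ of $T$. -}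

module Defs where

open import Data.Bool.Base using (if_then_else_)
open import Data.Empty using (⊥-elim)
open import Data.Fin.Base using (Fin; zero; suc)
open import Data.Fin.Properties using (any?; all?; injective⇒≤)
import Data.Fin.Properties as Finₚ
open import Data.Fin.Subset using (Subset; _∈_; ⊤; inside; outside)
open import Data.Fin.Subset.Properties using (_∈?_)
open import Data.Integer.Base as ℤ using (ℤ)
open import Data.List.Base as List
  using (List; []; _∷_; _++_; length; map; foldr; filter; allFin; cartesianProductWith)
open import Data.List.Membership.Propositional using () renaming (_∈_ to _∈ˡ_)
open import Data.List.Membership.Propositional.Properties using (∈-lookup)
open import Data.List.Relation.Unary.All as All using (All; []; _∷_)
open import Data.List.Relation.Unary.Any using (here; there)
import Data.List.Membership.DecPropositional as DecMembership
open import Data.List.Relation.Unary.AllPairs using ([]; _∷_)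
open import Data.List.Relation.Unary.Unique.Propositional using (Unique)
import Data.List.Relation.Unary.Unique.DecPropositional as DecUnique
open import Data.Nat.Base using (ℕ; zero; suc; _+_; _≤_; z≤n; s≤s; NonZero)
import Data.Nat.Properties as ℕₚ
open import Data.Product.Base using (∃; _×_; _,_; proj₁; proj₂; map₁; swap)
open import Data.Product using (∃!)
open import Data.Product.Properties using () renaming (≡-dec to ×-≡-dec)
open import Data.Sum.Base using (_⊎_; inj₁; inj₂)
open import Data.Vec.Base as Vec using (Vec; []; _∷_; lookup)
open import Data.Vec.Properties using () renaming (≡-dec to Vec-≡-dec)
import Data.Vec.Relation.Unary.All as VecAll
open import Level using (0ℓ)
open import Relation.Binary.Core using (Rel)
import Relation.Binary.Definitions as B
open import Relation.Binary.PropositionalEquality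
  using (_≡_; _≢_; refl; sym; trans; cong)
open import Relation.Nullary using (¬_; Dec; yes; no; does; ¬?)
open import Relation.Nullary.Decidable using (map′; _×-dec_; _⊎-dec_; _→-dec_)
open import Relation.Unary using (Pred; Decidable)

------------------------------------------------------------------------
-- Polynomials over ℤ in m variables

Monomial : ℕ → Set
Monomial m = Vec ℕ m

-- A list of terms, in any order and with repetitions allowed; polynomials
-- are compared by their coefficients only.

Poly : ℕ → Set
Poly m = List (ℤ × Monomial m)

coeff : ∀ {m} → Poly m → Monomial m → ℤ
coeff []            μ = ℤ.0ℤ
coeff ((c , ν) ∷ p) μ =
  (if does (Vec-≡-dec ℕₚ._≟_ ν μ) then c else ℤ.0ℤ) ℤ.+ coeff p μ

infix 4 _≈ᴾ_
_≈ᴾ_ : ∀ {m} → Poly m → Poly m → Set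
p ≈ᴾ q = ∀ μ → coeff p μ ≡ coeff q μ

constᴾ : ∀ {m} → ℤ → Poly m
constᴾ c = (c , Vec.replicate _ 0) ∷ []

varᴾ : ∀ {m} → Fin m → Poly m
varᴾ i = (ℤ.1ℤ , Vec.updateAt (Vec.replicate _ 0) i suc) ∷ []

0ᴾ 1ᴾ : ∀ {m} → Poly m
0ᴾ = []
1ᴾ = constᴾ ℤ.1ℤ

infixl 6 _+ᴾ_
infixl 7 _*ᴾ_

_+ᴾ_ _*ᴾ_ : ∀ {m} → Poly m → Poly m → Poly m
p +ᴾ q = p ++ q
p *ᴾ q = cartesianProductWith
  (λ (c , μ) (d , ν) → c ℤ.* d , Vec.zipWith _+_ μ ν) p q

-ᴾ_ : ∀ {m} → Poly m → Poly m
-ᴾ p = map (map₁ (λ c → ℤ.- c)) p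

sumᴾ prodᴾ : ∀ {m} → List (Poly m) → Poly m
sumᴾ  = foldr _+ᴾ_ 0ᴾ
prodᴾ = foldr _*ᴾ_ 1ᴾ

------------------------------------------------------------------------
-- Rational functions

-- A formal quotient represents a rational function only when its
-- denominator is not the zero polynomial.

record Frac (m : ℕ) : Set where
  constructor _/_
  field
    num den : Poly m

open Frac public

module _ {m : ℕ} where

  IsDefined : Frac m → Set
  IsDefined p = ¬ (den p ≈ᴾ 0ᴾ)

  -- Equality of rational functions, for defined quotients.
  infix 4 _≃_
  _≃_ : Frac m → Frac m → Set
  p ≃ q = num p *ᴾ den q ≈ᴾ num q *ᴾ den p

  fromPoly : Poly m → Frac m
  fromPoly p = p / 1ᴾ

  _+ᶠ_ _-ᶠ_ _*ᶠ_ _÷ᶠ_ : Frac m → Frac m → Frac m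
  (a / b) +ᶠ (c / d) = (a *ᴾ d +ᴾ c *ᴾ b) / (b *ᴾ d)
  (a / b) -ᶠ (c / d) = (a *ᴾ d +ᴾ (-ᴾ (c *ᴾ b))) / (b *ᴾ d)
  (a / b) *ᶠ (c / d) = (a *ᴾ c) / (b *ᴾ d)
  (a / b) ÷ᶠ (c / d) = (a *ᴾ d) / (b *ᴾ c)

------------------------------------------------------------------------
-- Arithmetic circuits with variables indexed by Fin m

data Op : Set where
  add sub mul div : Op

data Wire (m k : ℕ) : Set where
  var    : Fin m → Wire m k
  scalar : (c : ℕ) .{{_ : NonZero c}} → Wire m k
  gate   : Fin k → Wire m k

record Gate (m k : ℕ) : Set where
  constructor mkGate
  field
    op         : Op
    arg₁ arg₂  : Wire m k

-- A directed acyclic network of k gates, listed in a topological order.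
-- Gates are referred to by de Bruijn index: gate zero is the latest one.

infixl 5 _▷_
data Gates (m : ℕ) : ℕ → Set where
  []  : Gates m 0
  _▷_ : ∀ {k} → Gates m k → Gate m k → Gates m (suc k)

record Circuit (m : ℕ) : Set where
  field
    size   : ℕ
    gates  : Gates m size
    output : Wire m size

open Circuit public

⟦_⟧ : Op → ∀ {m} → Frac m → Frac m → Frac m
⟦ add ⟧ = _+ᶠ_
⟦ sub ⟧ = _-ᶠ_
⟦ mul ⟧ = _*ᶠ_
⟦ div ⟧ = _÷ᶠ_

wireValue : ∀ {m k} → Vec (Frac m) k → Wire m k → Frac m
wireValue vs (var i)    = fromPoly (varᴾ i)
wireValue vs (scalar c) = fromPoly (constᴾ (ℤ.+ c))
wireValue vs (gate g)   = lookup vs g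

gateValues : ∀ {m k} → Gates m k → Vec (Frac m) k
gateValues []                   = []
gateValues (gs ▷ mkGate o a b) =
  let vs = gateValues gs in ⟦ o ⟧ (wireValue vs a) (wireValue vs b) ∷ vs

-- Dividing by zero yields denominator 0, so the first condition says that no
-- gate divides by zero.
Computes : ∀ {m} → Circuit m → Frac m → Set
Computes c f =
  VecAll.All IsDefined (gateValues (gates c)) ×
  wireValue (gateValues (gates c)) (output c) ≃ f

data NoSub {m : ℕ} : ∀ {k} → Gates m k → Set where
  []  : NoSub []
  _▷_ : ∀ {k} {gs : Gates m k} {g} → NoSub gs → Gate.op g ≢ sub → NoSub (gs ▷ g)

SubtractionFree : ∀ {m} → Circuit m → Set
SubtractionFree c = NoSub (gates c)

------------------------------------------------------------------------
-- Graphs on the vertex set Fin n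

-- The edges are numbered, and edge e carries the variable numbered e.
-- The order in which the two ends of an undirected edge are listed is
-- immaterial.

record Graph (n : ℕ) : Set where
  field
    edges    : ℕ
    ends     : Fin edges → Fin n × Fin n
    loopless : ∀ e → proj₁ (ends e) ≢ proj₂ (ends e)
    simple   : ∀ e e′ → ends e ≡ ends e′ ⊎ ends e ≡ swap (ends e′) → e ≡ e′

-- The ends of an edge are its source and its target, in this order.

record Digraph (n : ℕ) : Set where
  field
    edges    : ℕ
    ends     : Fin edges → Fin n × Fin n
    loopless : ∀ e → proj₁ (ends e) ≢ proj₂ (ends e)
    simple   : ∀ e e′ → ends e ≡ ends e′ → e ≡ e′

-- Adj G T and Arc G T are the relations given by the spanning subgraph of G
-- with edge set T.

module _ {n : ℕ} where

  Adj : (G : Graph n) → Subset (Graph.edges G) → Rel (Fin n) 0ℓ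
  Adj G T u v = ∃ λ e → e ∈ T × (ends e ≡ (u , v) ⊎ ends e ≡ (v , u))
    where open Graph G

  Arc : (G : Digraph n) → Subset (Digraph.edges G) → Rel (Fin n) 0ℓ
  Arc G T u v = ∃ λ e → e ∈ T × ends e ≡ (u , v)
    where open Digraph G

-- Walk R u vs w: a walk from u to w whose vertices after u are vs, in order.
-- In a simple graph or digraph the vertices determine the edges of a walk.

data Walk {n : ℕ} (R : Rel (Fin n) 0ℓ) : Fin n → List (Fin n) → Fin n → Set where
  []  : ∀ {u} → Walk R u [] u
  _∷_ : ∀ {u v vs w} → R u v → Walk R v vs w → Walk R u (v ∷ vs) w

module _ {n : ℕ} (R : Rel (Fin n) 0ℓ) where

  Reachable : Rel (Fin n) 0ℓ
  Reachable u v = ∃ λ vs → Walk R u vs v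

  -- The base point u of the closed walk is the last entry of vs, so
  -- Unique vs says that the vertices of the cycle are distinct.
  IsCycle : Fin n → List (Fin n) → Set
  IsCycle u vs = Walk R u vs u × Unique vs × 3 ≤ length vs

module _ {n : ℕ} where

  Connected : Graph n → Set
  Connected G = ∀ u v → Reachable (Adj G ⊤) u v

  IsSpanningTree : (G : Graph n) → Subset (Graph.edges G) → Set
  IsSpanningTree G T =
    (∀ u v → Reachable (Adj G T) u v) ×
    (∀ u → ¬ ∃ λ vs → IsCycle (Adj G T) u vs)

  AllReach : Digraph n → Fin n → Set
  AllReach G r = ∀ v → Reachable (Arc G ⊤) v r

  -- Uniqueness is among all walks, including those that return to r:
  -- hence T has no edge leaving r.
  IsDirectedSpanningTree : (G : Digraph n) → Fin n → Subset (Digraph.edges G) → Set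
  IsDirectedSpanningTree G r T = ∀ v → ∃! _≡_ λ vs → Walk (Arc G T) v vs r

------------------------------------------------------------------------
-- Decidability of the spanning tree predicates

anyList? : ∀ {n} {P : Pred (List (Fin n)) 0ℓ} → Decidable P →
           ∀ b → Dec (∃ λ xs → length xs ≤ b × P xs)
anyList? P? zero =
  map′ (λ p → [] , z≤n , p) (λ { ([] , _ , p) → p }) (P? [])
anyList? P? (suc b) = map′
  (λ { (inj₁ p)                → [] , z≤n , p
     ; (inj₂ (x , xs , le , p)) → x ∷ xs , s≤s le , p })
  (λ { ([] , _ , p)             → inj₁ p
     ; (x ∷ xs , s≤s le , p)    → inj₂ (x , xs , le , p) })
  (P? [] ⊎-dec any? λ x → anyList? (λ xs → P? (x ∷ xs)) b)

unique-lookup : ∀ {n} {xs : List (Fin n)} → Unique xs →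
                ∀ i j → List.lookup xs i ≡ List.lookup xs j → i ≡ j
unique-lookup (_   ∷ _)  zero    zero    _  = refl
unique-lookup (x∉  ∷ _)  zero    (suc j) eq = ⊥-elim (All.lookup x∉ (∈-lookup j) eq)
unique-lookup (x∉  ∷ _)  (suc i) zero    eq = ⊥-elim (All.lookup x∉ (∈-lookup i) (sym eq))
unique-lookup (_   ∷ un) (suc i) (suc j) eq = cong suc (unique-lookup un i j eq)

unique-length : ∀ {n} {xs : List (Fin n)} → Unique xs → length xs ≤ n
unique-length un = injective⇒≤ (λ {i} {j} → unique-lookup un i j)

module _ {n : ℕ} {R : Rel (Fin n) 0ℓ} where

  private
    Path : Fin n → Fin n → Set
    Path u w = ∃ λ vs → Unique (u ∷ vs) × Walk R u vs w

    suffix : ∀ {v w x vs} → Unique (v ∷ vs) → Walk R v vs w → x ∈ˡ v ∷ vs → Path x w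
    suffix un       p       (here refl) = _ , un , p
    suffix (_ ∷ un) (_ ∷ p) (there x∈)  = suffix un p x∈

    notIn : ∀ {x : Fin n} {xs} → ¬ x ∈ˡ xs → All (x ≢_) xs
    notIn {xs = []}     _  = []
    notIn {xs = _ ∷ _} x∉ = (λ eq → x∉ (here eq)) ∷ notIn (λ x∈ → x∉ (there x∈))

  toPath : ∀ {u w vs} → Walk R u vs w → ∃ λ ws → Unique (u ∷ ws) × Walk R u ws w
  toPath [] = [] , ([] ∷ []) , []
  toPath {u} (_∷_ {v = v} r p) with toPath p
  ... | ws , un , q with DecMembership._∈?_ Finₚ._≟_ u (v ∷ ws)
  ...   | yes u∈ = suffix un q u∈
  ...   | no  u∉ = v ∷ ws , notIn u∉ ∷ un , r ∷ q

module _ {n : ℕ} (R : Rel (Fin n) 0ℓ) where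

  Oriented : Fin n → Set
  Oriented r =
    (∀ v → Reachable R v r) × (∀ w → ¬ R r w) ×
    (∀ v w w′ → R v w → R v w′ → w ≡ w′)

  oriented⇒unique : ∀ {r} → Oriented r → ∀ v → ∃! _≡_ λ vs → Walk R v vs r
  oriented⇒unique {r} (reach , sink , out) v =
    let vs , p = reach v in vs , p , λ q → uniq p q
    where
    uniq : ∀ {v vs ws} → Walk R v vs r → Walk R v ws r → vs ≡ ws
    uniq []      []      = refl
    uniq []      (s ∷ _) = ⊥-elim (sink _ s)
    uniq (s ∷ _) []      = ⊥-elim (sink _ s)
    uniq (s ∷ p) (t ∷ q) with out _ _ _ s t
    ... | refl = cong (_ ∷_) (uniq p q)

  unique⇒oriented : ∀ {r} → (∀ v → ∃! _≡_ λ vs → Walk R v vs r) → Oriented r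
  unique⇒oriented {r} h =
    (λ v → let vs , p , _ = h v in vs , p) ,
    (λ w s → let _ , p , _ = h w in []≢∷ (same [] (s ∷ p))) ,
    (λ v w w′ s t → let _ , p , _ = h w
                        _ , q , _ = h w′
                    in head≡ (same (s ∷ p) (t ∷ q)))
    where
    same : ∀ {v vs ws} → Walk R v vs r → Walk R v ws r → vs ≡ ws
    same {v} p q = let _ , _ , u = h v in trans (sym (u p)) (u q)
    []≢∷ : ∀ {x : Fin n} {xs : List (Fin n)} → [] ≢ x ∷ xs
    []≢∷ ()
    head≡ : ∀ {x y : Fin n} {xs ys : List (Fin n)} → x ∷ xs ≡ y ∷ ys → x ≡ y
    head≡ refl = refl

module _ {n : ℕ} {R : Rel (Fin n) 0ℓ} (R? : B.Decidable R) where

  walk? : ∀ u vs w → Dec (Walk R u vs w)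
  walk? u []       w = map′ (λ { refl → [] }) (λ { [] → refl }) (u Finₚ.≟ w)
  walk? u (v ∷ vs) w =
    map′ (λ (r , p) → r ∷ p) (λ { (r ∷ p) → r , p }) (R? u v ×-dec walk? v vs w)

  reachable? : B.Decidable (Reachable R)
  reachable? u w = map′
    (λ (vs , _ , p) → vs , p)
    (λ (_ , p) → let ws , un , q = toPath p
                 in ws , ℕₚ.≤-trans (ℕₚ.n≤1+n _) (unique-length un) , q)
    (anyList? (λ vs → walk? u vs w) n)

  cycle? : ∀ u → Dec (∃ λ vs → IsCycle R u vs)
  cycle? u = map′
    (λ (vs , _ , c) → vs , c)
    (λ (vs , c) → vs , unique-length (proj₁ (proj₂ c)) , c)
    (anyList? (λ vs → walk? u vs u ×-dec DecUnique.unique? Finₚ._≟_ vs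
                        ×-dec 3 ℕₚ.≤? length vs) n)

  oriented? : ∀ r → Dec (Oriented R r)
  oriented? r =
    all? (λ v → reachable? v r) ×-dec
    all? (λ w → ¬? (R? r w)) ×-dec
    all? (λ v → all? λ w → all? λ w′ →
            R? v w →-dec (R? v w′ →-dec (w Finₚ.≟ w′)))

  uniqueWalks? : ∀ r → Dec (∀ v → ∃! _≡_ λ vs → Walk R v vs r)
  uniqueWalks? r = map′ (oriented⇒unique R) (unique⇒oriented R) (oriented? r)

module _ {n : ℕ} where

  private
    _≟²_ : B.DecidableEquality (Fin n × Fin n)
    _≟²_ = ×-≡-dec Finₚ._≟_ Finₚ._≟_

  adj? : ∀ G T → B.Decidable (Adj {n} G T)
  adj? G T u v = any? λ e →
    e ∈? T ×-dec (Graph.ends G e ≟² (u , v) ⊎-dec Graph.ends G e ≟² (v , u))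

  arc? : ∀ G T → B.Decidable (Arc {n} G T)
  arc? G T u v = any? λ e → e ∈? T ×-dec Digraph.ends G e ≟² (u , v)

  isSpanningTree? : ∀ (G : Graph n) → Decidable (IsSpanningTree G)
  isSpanningTree? G T =
    all? (λ u → all? λ v → reachable? (adj? G T) u v) ×-dec
    all? (λ u → ¬? (cycle? (adj? G T) u))

  isDirectedSpanningTree? : ∀ (G : Digraph n) r → Decidable (IsDirectedSpanningTree G r)
  isDirectedSpanningTree? G r T = uniqueWalks? (arc? G T) r

------------------------------------------------------------------------
-- Generating functions

allSubsets : ∀ m → List (Subset m)
allSubsets zero    = [] ∷ []
allSubsets (suc m) = map (inside ∷_) (allSubsets m) ++ map (outside ∷_) (allSubsets m)

infix 8 x^_
x^_ : ∀ {m} → Subset m → Poly m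
x^ T = prodᴾ (map varᴾ (filter (_∈? T) (allFin _)))

module _ {n : ℕ} where

  f : (G : Graph n) → Poly (Graph.edges G)
  f G = sumᴾ (map x^_ (filter (isSpanningTree? G) (allSubsets _)))

  φ : (G : Digraph n) → Fin n → Poly (Digraph.edges G)
  φ G r = sumᴾ (map x^_ (filter (isDirectedSpanningTree? G r) (allSubsets _)))

{-# OPTIONS --safe #-}
-- Eliminating a vertex v other than the root, with s the sum of the weights w(v,b),
-- replaces w(i,j) by w(i,j) + w(i,v) w(v,j) / s and divides the weighted count of
-- arborescences by s; this costs O(n²) gates without subtraction.  The identity holds
-- because, after expanding along the edge v → b and contracting it, the count of the
-- graph in which column v is distributed over the other columns according to a
-- vector t with sum 1 is the t-average of the counts of the contracted graphs.
-- The count is the generating function because it is affine in every edge weight, so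
-- it expands over edge sets, and at a 0-1 functional graph it tests whether every
-- vertex is led to the root.  An undirected graph is replaced by the digraph with both
-- orientations of every edge: a spanning tree has exactly one orientation towards
-- the root.  Identities of rational functions are checked at positive integer points.
module Submission where

open import Algebra.Bundles using (CommutativeRing)
open import Algebra.Structures using (IsCommutativeRing)
open import Data.Bool.Base using (Bool; _∧_; _∨_; false; if_then_else_; true)
open import Data.Bool.ListAction using (any)
import Data.Bool.Properties as Boolₚ
open import Data.Empty using (⊥; ⊥-elim)
open import Data.Fin.Base as Fin using (Fin; _↑ʳ_; _↑ˡ_; splitAt; suc; zero)
import Data.Fin.Properties as Finₚ
open import Data.Fin.Subset using (Subset; _∪_; _⊆_; inside; outside; ⊤) renaming (_∈_ to _∈ₛ_)
open import Data.Fin.Subset.Properties using (drop-there; x∈p∪q⁺; x∈p∪q⁻; ∈⊤; ⊆-antisym) renaming (_∈?_ to _∈ₛ?_)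
open import Data.Integer.Base as ℤ using (ℤ)
import Data.Integer.Properties as ℤₚ
open import Data.Integer.Tactic.RingSolver using () renaming (solve-∀ to solve-∀ᶻ)
open import Data.List.Base as List using (List; []; _++_; _∷_; allFin; filter; length; map; tabulate)
import Data.List.Membership.DecPropositional as DecMembership
open import Data.List.Membership.Propositional using (_∈_)
open import Data.List.Membership.Propositional.Properties using (∈-++⁺ʳ; ∈-++⁺ˡ; ∈-allFin; ∈-filter⁺; ∈-filter⁻; ∈-map⁺; ∈-map⁻)
open import Data.List.Properties using (++-identityʳ; filter-accept; filter-reject)
open import Data.List.Relation.Unary.All as All using (All; []; _∷_)
import Data.List.Relation.Unary.All.Properties as Allₚ
open import Data.List.Relation.Unary.AllPairs as AllPairs using ([]; _∷_)
open import Data.List.Relation.Unary.Any using (here; there)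
open import Data.List.Relation.Unary.Unique.Propositional using (Unique)
import Data.List.Relation.Unary.Unique.Propositional.Properties as Uniqueₚ
open import Data.Maybe.Base as Maybe using (Maybe; just; maybe′; nothing)
open import Data.Maybe.Properties using (just-injective) renaming (≡-dec to Maybe-≡-dec)
open import Data.Nat.Base as ℕ using (_<_; _^_; _≤_; suc; s≤s; zero; z≤n; ℕ)
import Data.Nat.Coprimality as Coprimality
import Data.Nat.Divisibility as ℕ∣
import Data.Nat.Properties as ℕₚ
import Data.Nat.Tactic.RingSolver as ℕ-RingSolver
open import Data.Product.Base using (_,_; _×_; proj₁; proj₂; swap; ∃)
open import Data.Product.Properties using () renaming (≡-dec to ×-≡-dec)
open import Data.Rational.Base as ℚ using (0ℚ; 1ℚ; ½; ℚ)
import Data.Rational.Properties as ℚₚ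
import Data.Rational.Unnormalised.Base as ℚᵘ
import Data.Rational.Unnormalised.Properties as ℚᵘₚ
open import Data.Sum.Base as Sum using (_⊎_; inj₁; inj₂)
open import Data.Vec.Base as Vec using (Vec; []; _∷_; here; lookup; there)
open import Data.Vec.Properties using ([]=⇒lookup; lookup-++ʳ; lookup-++ˡ; lookup⇒[]=; lookup∘tabulate) renaming (≡-dec to Vec-≡-dec)
import Data.Vec.Relation.Unary.All as VecAll
import Data.Vec.Relation.Unary.All.Properties as VecAllₚ
open import Defs
open import Function.Base using (_∘_; id)
open import Level using (0ℓ)
open import Relation.Binary.Core using (Rel)
import Relation.Binary.Definitions as B
open import Relation.Binary.PropositionalEquality
open import Relation.Nullary using (Dec; does; no; yes; ¬?; ¬_)
open import Relation.Nullary.Decidable using (_×-dec_; _⊎-dec_; dec-false; dec-true; dec⇒maybe)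
open import Relation.Unary using (Decidable; Pred)
open import Tactic.RingSolver using (solve-∀)
open import Tactic.RingSolver.Core.AlmostCommutativeRing using (AlmostCommutativeRing; fromCommutativeRing)

open ≡-Reasoning

-- The main obstacle is zero: many entries of the weight matrix vanish, a circuit without
-- subtraction cannot produce 0, and no gate may divide by it. Hence every value that is computed
-- carries a numerator and a denominator that are nonempty sums of terms with positive coefficients;
-- such a value is nonzero at each positive integer point, and its denominator is a nonzero
-- polynomial. Vanishing entries are recorded as Booleans outside the circuit. A pivot is then a
-- legitimate divisor as soon as one of its summands is present. This is what reachability of the
-- root is for, and it survives elimination because a passage through the eliminated vertex is
-- shortcut by a new entry.
--
-- The count is defined by recursive contraction and not as a minor of a Laplacian: linearity in a
-- row and the values on functional graphs can then be read off the recursion. The price is that the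
-- behaviour under a rank-one change, immediate for determinants, needs a proof of its own.

infixl 6 _+_
infixl 7 _*_
infix  8 -_

-- Sealed, so that unification treats the operations as injective.
opaque
  _+_ _*_ : ℚ → ℚ → ℚ
  _+_ = ℚ._+_
  _*_ = ℚ._*_

  -_ : ℚ → ℚ
  -_ = ℚ.-_

  isCommutativeRing : IsCommutativeRing _≡_ _+_ _*_ -_ 0ℚ 1ℚ
  isCommutativeRing = ℚₚ.+-*-isCommutativeRing

  ½+½≡1 : ½ * 1ℚ + ½ * 1ℚ ≡ 1ℚ
  ½+½≡1 = refl

ℚ-commutativeRing : CommutativeRing _ _
ℚ-commutativeRing = record { isCommutativeRing = isCommutativeRing }

open CommutativeRing ℚ-commutativeRing
  using (+-identityˡ; +-identityʳ; +-assoc; +-comm; *-identityˡ; *-identityʳ; *-assoc; *-comm;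
         zeroˡ; zeroʳ; distribˡ)

ring : AlmostCommutativeRing _ _
ring = fromCommutativeRing ℚ-commutativeRing (λ p → dec⇒maybe (0ℚ ℚₚ.≟ p))

-- Finite sums

module _ {A : Set} where

  ∑ : List A → (A → ℚ) → ℚ
  ∑ []       f = 0ℚ
  ∑ (x ∷ xs) f = f x + ∑ xs f

  ∑-cong : ∀ xs {f g : A → ℚ} → (∀ {x} → x ∈ xs → f x ≡ g x) → ∑ xs f ≡ ∑ xs g
  ∑-cong []       eq = refl
  ∑-cong (x ∷ xs) eq = cong₂ _+_ (eq (here refl)) (∑-cong xs (eq ∘ there))

  ∑-zero : ∀ xs {f : A → ℚ} → (∀ {x} → x ∈ xs → f x ≡ 0ℚ) → ∑ xs f ≡ 0ℚ
  ∑-zero []       eq = refl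
  ∑-zero (x ∷ xs) eq = trans (cong₂ _+_ (eq (here refl)) (∑-zero xs (eq ∘ there))) (+-identityˡ 0ℚ)

  ∑-+ : ∀ xs (f g : A → ℚ) → ∑ xs (λ x → f x + g x) ≡ ∑ xs f + ∑ xs g
  ∑-+ []       f g = sym (+-identityˡ 0ℚ)
  ∑-+ (x ∷ xs) f g = trans (cong (f x + g x +_) (∑-+ xs f g)) (interchange _ _ _ _)
    where
    opaque
      unfolding _+_
      interchange : ∀ a b c d → (a + b) + (c + d) ≡ (a + c) + (b + d)
      interchange = solve-∀ ring

  ∑-*ˡ : ∀ xs c (f : A → ℚ) → ∑ xs (λ x → c * f x) ≡ c * ∑ xs f
  ∑-*ˡ []       c f = sym (zeroʳ c)
  ∑-*ˡ (x ∷ xs) c f =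
    trans (cong (c * f x +_) (∑-*ˡ xs c f)) (sym (distribˡ c (f x) (∑ xs f)))

  ∑-single : ∀ {xs} {f : A → ℚ} {y} → Unique xs → y ∈ xs →
             (∀ {x} → x ∈ xs → x ≢ y → f x ≡ 0ℚ) → ∑ xs f ≡ f y
  ∑-single {f = f} (x∉ ∷ un) (here refl) eq =
    trans (cong (f _ +_) (∑-zero _ λ x∈ → eq (there x∈) (≢-sym (All.lookup x∉ x∈))))
          (+-identityʳ _)
  ∑-single {f = f} (x∉ ∷ un) (there y∈) eq =
    trans (cong₂ _+_ (eq (here refl) (All.lookup x∉ y∈)) (∑-single un y∈ (eq ∘ there)))
          (+-identityˡ _)

  ∑-++ : ∀ xs ys (f : A → ℚ) → ∑ (xs ++ ys) f ≡ ∑ xs f + ∑ ys f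
  ∑-++ []       ys f = sym (+-identityˡ _)
  ∑-++ (x ∷ xs) ys f = trans (cong (f x +_) (∑-++ xs ys f)) (sym (+-assoc _ _ _))

∑-map : ∀ {A B : Set} (g : B → A) xs (f : A → ℚ) → ∑ (map g xs) f ≡ ∑ xs (f ∘ g)
∑-map g []       f = refl
∑-map g (x ∷ xs) f = cong (f (g x) +_) (∑-map g xs f)

∑-swap : ∀ {A B : Set} (xs : List A) (ys : List B) (f : A → B → ℚ) →
         ∑ xs (λ x → ∑ ys (f x)) ≡ ∑ ys (λ y → ∑ xs (λ x → f x y))
∑-swap []       ys f = sym (∑-zero ys (λ _ → refl))
∑-swap (x ∷ xs) ys f =
  trans (cong (∑ ys (f x) +_) (∑-swap xs ys f))
        (sym (∑-+ ys (f x) (λ y → ∑ xs (λ z → f z y))))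

module _ {n : ℕ} where

  δ : Fin n → Fin n → ℚ
  δ i j = if does (i Finₚ.≟ j) then 1ℚ else 0ℚ

  δ-refl : ∀ i → δ i i ≡ 1ℚ
  δ-refl i rewrite dec-true (i Finₚ.≟ i) refl = refl

  δ-≢ : ∀ {i j} → i ≢ j → δ i j ≡ 0ℚ
  δ-≢ {i} {j} i≢j rewrite dec-false (i Finₚ.≟ j) i≢j = refl

  ∑-δ : ∀ {xs j} → Unique xs → j ∈ xs → (g : Fin n → ℚ) → ∑ xs (λ i → δ i j * g i) ≡ g j
  ∑-δ {j = j} un j∈ g =
    trans (∑-single un j∈ λ {i} _ i≢j → trans (cong (_* g i) (δ-≢ i≢j)) (zeroˡ (g i)))
          (trans (cong (_* g j) (δ-refl j)) (*-identityˡ (g j)))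

-- Weighted arborescences

Matrix : ℕ → Set
Matrix n = Fin n → Fin n → ℚ

infixl 6 _⊕_⊗_
_⊕_⊗_ : ∀ {n} → Matrix n → (Fin n → ℚ) → (Fin n → ℚ) → Matrix n
(A ⊕ c ⊗ t) i j = A i j + c i * t j

contract : ∀ {n} → Matrix n → Fin n → Fin n → Matrix n
contract W v b = W ⊕ (λ i → W i v) ⊗ (λ j → δ j b)

-- The weighted count of the arborescences on r ∷ vs with root r, by the choice
-- of the edge v → b leaving the first vertex, which is then contracted.
-- Diagonal entries play no role.
arb : ∀ {n} → Fin n → List (Fin n) → Matrix n → ℚ
arb r []       W = 1ℚ
arb r (v ∷ vs) W = ∑ (r ∷ vs) λ b → W v b * arb r vs (contract W v b)

module _ {n : ℕ} (r : Fin n) where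

  -- Contraction leaves the column of the contracted vertex in place instead of deleting it; this
  -- lemma makes such leftovers harmless.
  arb-cong : ∀ vs {A B : Matrix n} →
             (∀ {i j} → i ∈ vs → j ∈ r ∷ vs → A i j ≡ B i j) → arb r vs A ≡ arb r vs B
  arb-cong []       eq = refl
  arb-cong (v ∷ vs) eq = ∑-cong (r ∷ vs) λ {b} b∈ → cong₂ _*_ (eq (here refl) (weaken b∈))
    (arb-cong vs λ {i} {j} i∈ j∈ → cong₂ _+_ (eq (there i∈) (weaken j∈))
      (cong (_* δ j b) (eq (there i∈) (there (here refl)))))
    where
    weaken : ∀ {j} → j ∈ r ∷ vs → j ∈ r ∷ v ∷ vs
    weaken (here refl) = here refl
    weaken (there j∈)  = there (there j∈)

  tail-unique : ∀ {v : Fin n} {vs} → Unique (r ∷ v ∷ vs) → Unique (r ∷ vs)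
  tail-unique ((_ ∷ r∉) ∷ _ ∷ un) = r∉ ∷ un

  second-≢ : ∀ {v j : Fin n} {vs} → Unique (r ∷ v ∷ vs) → j ∈ r ∷ vs → j ≢ v
  second-≢ ((r≢v ∷ _) ∷ _) (here refl) = r≢v
  second-≢ (_ ∷ v∉ ∷ _)    (there j∈)  = ≢-sym (All.lookup v∉ j∈)

  -- In terms of the reduced Laplacian: since `t` has total 1, adding `c ⊗ t` adds the diagonal
  -- matrix of `c` and subtracts a rank-one matrix linear in `t`, and a determinant is affine along
  -- rank-one changes.
  Averaging : List (Fin n) → Set
  Averaging vs = ∀ A c t → ∑ (r ∷ vs) t ≡ 1ℚ →
    arb r vs (A ⊕ c ⊗ t) ≡ ∑ (r ∷ vs) λ b → t b * arb r vs (A ⊕ c ⊗ λ j → δ j b)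

  private
    module Step (vs : List (Fin n)) (un : Unique (r ∷ vs)) (avg : Averaging vs)
                (A : Matrix n) (c a : Fin n → ℚ) where
      X = r ∷ vs

      -- In `averaging`, `a` is the column of the vertex being contracted, so `g j k` is the count
      -- with that vertex merged into `j` and the extra column `c` put on `k`.
      g : Fin n → Fin n → ℚ
      g j k = arb r vs (A ⊕ a ⊗ (λ i → δ i j) ⊕ c ⊗ (λ i → δ i k))

      mid : Fin n → Fin n → Fin n → ℚ
      mid j k i = ½ * δ i j + ½ * δ i k

      two-point : ∀ {j k} → j ∈ X → k ∈ X → ∀ f → ∑ X (λ i → mid j k i * f i) ≡ ½ * f j + ½ * f k
      two-point {j} {k} j∈ k∈ f = begin
        ∑ X (λ i → mid j k i * f i)
          ≡⟨ ∑-cong X (λ {i} _ → expand (δ i j) (δ i k) (f i)) ⟩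
        ∑ X (λ i → ½ * (δ i j * f i) + ½ * (δ i k * f i))
          ≡⟨ ∑-+ X _ _ ⟩
        ∑ X (λ i → ½ * (δ i j * f i)) + ∑ X (λ i → ½ * (δ i k * f i))
          ≡⟨ cong₂ _+_ (∑-*ˡ X ½ _) (∑-*ˡ X ½ _) ⟩
        ½ * ∑ X (λ i → δ i j * f i) + ½ * ∑ X (λ i → δ i k * f i)
          ≡⟨ cong₂ (λ x y → ½ * x + ½ * y) (∑-δ un j∈ f) (∑-δ un k∈ f) ⟩
        ½ * f j + ½ * f k ∎
        where
        opaque
          unfolding _+_
          expand : ∀ x y z → (½ * x + ½ * y) * z ≡ ½ * (x * z) + ½ * (y * z)
          expand = solve-∀ ring

      mid-sum : ∀ {j k} → j ∈ X → k ∈ X → ∑ X (mid j k) ≡ 1ℚ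
      mid-sum j∈ k∈ = trans (∑-cong X (λ _ → sym (*-identityʳ _))) (trans (two-point j∈ k∈ (λ _ → 1ℚ)) ½+½≡1)

      avg-mid : ∀ B d {j k} → j ∈ X → k ∈ X → arb r vs (B ⊕ d ⊗ mid j k) ≡
                ½ * arb r vs (B ⊕ d ⊗ (λ i → δ i j)) + ½ * arb r vs (B ⊕ d ⊗ (λ i → δ i k))
      avg-mid B d j∈ k∈ = trans (avg B d _ (mid-sum j∈ k∈)) (two-point j∈ k∈ _)

      -- Evaluate A ⊕ a ⊗ m ⊕ c ⊗ m, with m the midpoint of δ j and δ k, both as
      -- A ⊕ (a + c) ⊗ m and by averaging in the two summands separately.
      symmetry : ∀ {j k} → j ∈ X → k ∈ X → g j k + g k j ≡ g j j + g k k
      symmetry {j} {k} j∈ k∈ = cancel _ _ _ _ (trans (sym joint) separate)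
        where
        m = mid j k
        opaque
          unfolding _+_
          swap⊕ : ∀ x y p q → x + y * p + q ≡ x + q + y * p
          swap⊕ = solve-∀ ring
        both : Matrix n
        both = A ⊕ a ⊗ m ⊕ c ⊗ m
        opaque
          unfolding _+_
          merge : ∀ x y z w → x + y * w + z * w ≡ x + (y + z) * w
          merge = solve-∀ ring
        joint : arb r vs both ≡ ½ * g j j + ½ * g k k
        joint = begin
          arb r vs both
            ≡⟨ arb-cong vs (λ {p} {q} _ _ → merge (A p q) (a p) (c p) (m q)) ⟩
          arb r vs (A ⊕ (λ i → a i + c i) ⊗ m)
            ≡⟨ avg-mid A _ j∈ k∈ ⟩
          _ ≡⟨ cong₂ (λ x y → ½ * x + ½ * y)
                 (arb-cong vs (λ {p} {q} _ _ → sym (merge (A p q) (a p) (c p) _)))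
                 (arb-cong vs (λ {p} {q} _ _ → sym (merge (A p q) (a p) (c p) _))) ⟩
          ½ * g j j + ½ * g k k ∎
        inner : ∀ {i} → i ∈ X → arb r vs (A ⊕ a ⊗ m ⊕ c ⊗ (λ l → δ l i)) ≡ ½ * g j i + ½ * g k i
        inner {i} i∈ = begin
          arb r vs (A ⊕ a ⊗ m ⊕ c ⊗ (λ l → δ l i))
            ≡⟨ arb-cong vs (λ {p} {q} _ _ → swap⊕ (A p q) (a p) (m q) _) ⟩
          arb r vs (A ⊕ c ⊗ (λ l → δ l i) ⊕ a ⊗ m)
            ≡⟨ avg-mid _ a j∈ k∈ ⟩
          _ ≡⟨ cong₂ (λ x y → ½ * x + ½ * y)
                 (arb-cong vs (λ {p} {q} _ _ → sym (swap⊕ (A p q) (a p) _ _)))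
                 (arb-cong vs (λ {p} {q} _ _ → sym (swap⊕ (A p q) (a p) _ _))) ⟩
          ½ * g j i + ½ * g k i ∎
        separate : arb r vs both ≡ ½ * (½ * g j j + ½ * g k j) + ½ * (½ * g j k + ½ * g k k)
        separate = trans (avg-mid _ c j∈ k∈)
          (cong₂ (λ x y → ½ * x + ½ * y) (inner j∈) (inner k∈))
        cancel : ∀ x y z w → ½ * x + ½ * w ≡ ½ * (½ * x + ½ * z) + ½ * (½ * y + ½ * w) →
                 y + z ≡ x + w
        cancel x y z w eq = begin
          y + z ≡⟨ e₁ x y z w ⟩
          four * (½ * (½ * x + ½ * z) + ½ * (½ * y + ½ * w)) + - (x + w)
            ≡⟨ cong (λ u → four * u + - (x + w)) (sym eq) ⟩
          four * (½ * x + ½ * w) + - (x + w) ≡⟨ e₂ x w ⟩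
          x + w ∎
          where
          four = 1ℚ + 1ℚ + 1ℚ + 1ℚ
          opaque
            unfolding _+_
            e₁ : ∀ x y z w → y + z ≡ (1ℚ + 1ℚ + 1ℚ + 1ℚ) * (½ * (½ * x + ½ * z) + ½ * (½ * y + ½ * w)) + - (x + w)
            e₁ = solve-∀ ring
            e₂ : ∀ x w → (1ℚ + 1ℚ + 1ℚ + 1ℚ) * (½ * x + ½ * w) + - (x + w) ≡ x + w
            e₂ = solve-∀ ring

      module _ (t : Fin n → ℚ) where

        diagonal = ∑ X λ j → t j * g j j

        -- A quadratic form sees only the symmetric part of its matrix, and by `symmetry` that part
        -- of `g` is the mean of two diagonal entries. The factor `∑ X t` stays because in
        -- `averaging` the total 1 includes the mass on `v`, which lies outside `X`.
        double-sum : ∑ X (λ j → t j * ∑ X (λ k → t k * g j k)) ≡ ∑ X t * diagonal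
        double-sum = halve _ _ (begin
          S + S
            ≡⟨ cong₂ _+_ expand (trans expand (∑-swap X X _)) ⟩
          ∑ X (λ j → ∑ X λ k → t j * (t k * g j k)) + ∑ X (λ j → ∑ X λ k → t k * (t j * g k j))
            ≡⟨ sym (∑∑-+ _ _) ⟩
          ∑ X (λ j → ∑ X λ k → t j * (t k * g j k) + t k * (t j * g k j))
            ≡⟨ ∑-cong X (λ {j} j∈ → ∑-cong X λ {k} k∈ → symmetrise (t j) (t k) (symmetry j∈ k∈)) ⟩
          ∑ X (λ j → ∑ X λ k → t j * g j j * t k + t j * (t k * g k k))
            ≡⟨ ∑∑-+ _ _ ⟩
          ∑ X (λ j → ∑ X λ k → t j * g j j * t k) + ∑ X (λ j → ∑ X λ k → t j * (t k * g k k))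
            ≡⟨ cong₂ _+_ left right ⟩
          ∑ X t * diagonal + ∑ X t * diagonal ∎)
          where
          S = ∑ X (λ j → t j * ∑ X (λ k → t k * g j k))
          halve : ∀ x y → x + x ≡ y + y → x ≡ y
          halve x y eq = trans (e x) (trans (cong (½ *_) eq) (sym (e y)))
            where
            opaque
              unfolding _+_
              e : ∀ x → x ≡ ½ * (x + x)
              e = solve-∀ ring
          expand : S ≡ ∑ X (λ j → ∑ X λ k → t j * (t k * g j k))
          expand = ∑-cong X λ {j} _ → sym (∑-*ˡ X (t j) _)
          ∑∑-+ : ∀ (p q : Fin n → Fin n → ℚ) → ∑ X (λ j → ∑ X λ k → p j k + q j k) ≡
                 ∑ X (λ j → ∑ X (p j)) + ∑ X (λ j → ∑ X (q j))
          ∑∑-+ p q = trans (∑-cong X λ {j} _ → ∑-+ X (p j) (q j)) (∑-+ X _ _)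
          symmetrise : ∀ x y {p q p′ q′} → p + q ≡ p′ + q′ →
                       x * (y * p) + y * (x * q) ≡ x * p′ * y + x * (y * q′)
          symmetrise x y {p} {q} {p′} {q′} eq =
            trans (e₁ x y p q) (trans (cong (x * y *_) eq) (e₂ x y p′ q′))
            where
            opaque
              unfolding _+_
              e₁ : ∀ x y p q → x * (y * p) + y * (x * q) ≡ x * y * (p + q)
              e₁ = solve-∀ ring
              e₂ : ∀ x y p q → x * y * (p + q) ≡ x * p * y + x * (y * q)
              e₂ = solve-∀ ring
          left : ∑ X (λ j → ∑ X λ k → t j * g j j * t k) ≡ ∑ X t * diagonal
          left = trans (∑-cong X λ {j} _ → trans (∑-*ˡ X (t j * g j j) t) (*-comm _ (∑ X t)))
                       (∑-*ˡ X (∑ X t) _)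
          right : ∑ X (λ j → ∑ X λ k → t j * (t k * g k k)) ≡ ∑ X t * diagonal
          right = trans (∑-cong X λ {j} _ → trans (∑-*ˡ X (t j) _) (*-comm (t j) diagonal))
                  (trans (∑-*ˡ X diagonal t) (*-comm diagonal _))

  -- Induction on the vertices. Contracting `v` into `j` moves the mass `t v` to `j`, so the
  -- induction hypothesis applies to a new vector of total 1. The result is quadratic in `t`;
  -- `double-sum` rewrites the quadratic part as a multiple of `D`, and the masses on `X` and on `v`
  -- then add up to 1.
  averaging : ∀ {vs} → Unique (r ∷ vs) → Averaging vs
  averaging {[]} _ A c t t≡1 =
    trans (sym t≡1) (cong (_+ 0ℚ) (sym (*-identityʳ (t r))))
  averaging {v ∷ vs} un′ A c t t≡1 = begin
    arb r (v ∷ vs) (A ⊕ c ⊗ t)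
      ≡⟨ ∑-cong X (λ {j} j∈ → cong ((A v j + c v * t j) *_) (left j∈)) ⟩
    ∑ X (λ j → (A v j + c v * t j) * (row j + t v * g j j))
      ≡⟨ ∑-cong X (λ {j} _ → e₁ (A v j) (c v) (t j) (row j) (t v) (g j j)) ⟩
    ∑ X (λ j → (A v j * row j + t v * (A v j * g j j)) + (c v * (t j * row j) + c v * t v * (t j * g j j)))
      ≡⟨ trans (∑-+ X _ _) (cong₂ _+_ (∑-+ X _ _) (∑-+ X _ _)) ⟩
    (P + ∑ X (λ j → t v * (A v j * g j j)))
      + (∑ X (λ j → c v * (t j * row j)) + ∑ X (λ j → c v * t v * (t j * g j j)))
      ≡⟨ cong₂ _+_ (cong (P +_) (∑-*ˡ X _ _)) (cong₂ _+_ (∑-*ˡ X _ _) (∑-*ˡ X _ _)) ⟩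
    (P + t v * Q) + (c v * ∑ X (λ j → t j * row j) + c v * t v * D)
      ≡⟨ cong (λ s → (P + t v * Q) + (c v * s + c v * t v * D)) (double-sum t) ⟩
    (P + t v * Q) + (c v * (∑ X t * D) + c v * t v * D)
      ≡⟨ e₂ P (t v) Q (c v) (∑ X t) D ⟩
    t v * Q + (P + c v * ((∑ X t + t v) * D))
      ≡⟨ cong (λ s → t v * Q + (P + c v * s)) (trans (cong (_* D) total) (*-identityˡ D)) ⟩
    t v * Q + (P + c v * D)
      ≡⟨ cong₂ (λ x y → t v * x + y) (sym at-v) (sym at-X) ⟩
    t v * R v + ∑ X (λ b → t b * R b)
      ≡⟨ e₃ (t v * R v) (t r * R r) (∑ vs (λ b → t b * R b)) ⟩
    ∑ (r ∷ v ∷ vs) (λ b → t b * R b) ∎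
    where
    un = tail-unique un′
    open Step vs un (averaging un) A c (λ i → A i v)
    row : Fin n → ℚ
    row j = ∑ X (λ k → t k * g j k)
    P = ∑ X (λ j → A v j * row j)
    Q = ∑ X (λ j → A v j * g j j)
    D = diagonal t
    R : Fin n → ℚ
    R b = arb r (v ∷ vs) (A ⊕ c ⊗ λ j → δ j b)

    opaque
      unfolding _+_
      e₁ : ∀ a c t p s q → (a + c * t) * (p + s * q) ≡
           (a * p + s * (a * q)) + (c * (t * p) + c * s * (t * q))
      e₁ = solve-∀ ring
      e₂ : ∀ p t q c s d → (p + t * q) + (c * (s * d) + c * t * d) ≡ t * q + (p + c * ((s + t) * d))
      e₂ = solve-∀ ring
      e₃ : ∀ x y z → x + (y + z) ≡ y + (x + z)
      e₃ = solve-∀ ring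
      e₄ : ∀ a c t b s d → a + c * t + (b + c * s) * d ≡ a + b * d + c * (t + s * d)
      e₄ = solve-∀ ring

    total : ∑ X t + t v ≡ 1ℚ
    total = trans (trans (+-comm (∑ X t) (t v)) (e₃ (t v) (t r) (∑ vs t))) t≡1

    ∑-shift : ∀ {j} → j ∈ X → (f : Fin n → ℚ) → ∑ X (λ k → (t k + t v * δ k j) * f k) ≡
              ∑ X (λ k → t k * f k) + t v * f j
    ∑-shift {j} j∈ f = begin
      ∑ X (λ k → (t k + t v * δ k j) * f k)
        ≡⟨ ∑-cong X (λ {k} _ → distrib (t k) (t v) (δ k j) (f k)) ⟩
      ∑ X (λ k → t k * f k + t v * (δ k j * f k))
        ≡⟨ trans (∑-+ X _ _) (cong (_ +_) (∑-*ˡ X (t v) _)) ⟩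
      ∑ X (λ k → t k * f k) + t v * ∑ X (λ k → δ k j * f k)
        ≡⟨ cong (λ s → _ + t v * s) (∑-δ un j∈ f) ⟩
      ∑ X (λ k → t k * f k) + t v * f j ∎
      where
      opaque
        unfolding _+_
        distrib : ∀ a b c d → (a + b * c) * d ≡ a * d + b * (c * d)
        distrib = solve-∀ ring

    left : ∀ {j} → j ∈ X → arb r vs (contract (A ⊕ c ⊗ t) v j) ≡ row j + t v * g j j
    left {j} j∈ = begin
      arb r vs (contract (A ⊕ c ⊗ t) v j)
        ≡⟨ arb-cong vs (λ {i} {k} _ _ → e₄ (A i k) (c i) (t k) (A i v) (t v) (δ k j)) ⟩
      arb r vs (contract A v j ⊕ c ⊗ t′)
        ≡⟨ averaging un _ c t′ t′≡1 ⟩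
      ∑ X (λ k → t′ k * g j k)
        ≡⟨ ∑-shift j∈ (g j) ⟩
      row j + t v * g j j ∎
      where
      t′ : Fin n → ℚ
      t′ k = t k + t v * δ k j
      t′≡1 : ∑ X t′ ≡ 1ℚ
      t′≡1 = begin
        ∑ X t′                           ≡⟨ ∑-cong X (λ _ → sym (*-identityʳ _)) ⟩
        ∑ X (λ k → t′ k * 1ℚ)            ≡⟨ ∑-shift j∈ (λ _ → 1ℚ) ⟩
        ∑ X (λ k → t k * 1ℚ) + t v * 1ℚ  ≡⟨ cong₂ _+_ (∑-cong X λ _ → *-identityʳ _) (*-identityʳ _) ⟩
        ∑ X t + t v                      ≡⟨ total ⟩
        1ℚ                               ∎

    -- The column `c` sits on `v` and follows it to `j`, hence the diagonal values.
    at-v : R v ≡ Q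
    at-v = ∑-cong X λ {j} j∈ → cong₂ _*_
      (trans (cong (λ d → A v j + c v * d) (δ-≢ (second-≢ un′ j∈))) (e₅ (A v j) (c v)))
      (arb-cong vs λ {i} {k} _ k∈ → trans
        (cong₂ (λ d d′ → A i k + c i * d + (A i v + c i * d′) * δ k j) (δ-≢ (second-≢ un′ k∈)) (δ-refl v))
        (e₆ (A i k) (c i) (A i v) (δ k j)))
      where
      opaque
        unfolding _+_
        e₅ : ∀ a c → a + c * 0ℚ ≡ a
        e₅ = solve-∀ ring
        e₆ : ∀ a c b d → a + c * 0ℚ + (b + c * 1ℚ) * d ≡ a + b * d + c * d
        e₆ = solve-∀ ring

    -- Here `c` stays on `b` while the column of `v` moves to `j`; the term with `c v` comes from
    -- the extra weight that `c` puts on the edge from `v` to `b`.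
    at-b : ∀ {b} → b ∈ X → R b ≡ ∑ X (λ j → A v j * g j b) + c v * g b b
    at-b {b} b∈ = begin
      R b
        ≡⟨ ∑-cong X (λ {j} _ → cong (_ *_) (arb-cong vs λ {i} {k} _ _ → trans
             (cong (λ d → A i k + c i * δ k b + (A i v + c i * d) * δ k j) (δ-≢ (≢-sym (second-≢ un′ b∈))))
             (e₇ (A i k) (c i) (δ k b) (A i v) (δ k j)))) ⟩
      ∑ X (λ j → (A v j + c v * δ j b) * g j b)
        ≡⟨ ∑-cong X (λ {j} _ → distrib (A v j) (c v) (δ j b) (g j b)) ⟩
      ∑ X (λ j → A v j * g j b + c v * (δ j b * g j b))
        ≡⟨ trans (∑-+ X _ _) (cong (∑ X (λ j → A v j * g j b) +_) (∑-*ˡ X (c v) _)) ⟩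
      ∑ X (λ j → A v j * g j b) + c v * ∑ X (λ j → δ j b * g j b)
        ≡⟨ cong (λ s → ∑ X (λ j → A v j * g j b) + c v * s) (∑-δ un b∈ (λ j → g j b)) ⟩
      ∑ X (λ j → A v j * g j b) + c v * g b b ∎
      where
      opaque
        unfolding _+_
        e₇ : ∀ a c d b e → a + c * d + (b + c * 0ℚ) * e ≡ a + b * e + c * d
        e₇ = solve-∀ ring
        distrib : ∀ a b c d → (a + b * c) * d ≡ a * d + b * (c * d)
        distrib = solve-∀ ring

    at-X : ∑ X (λ b → t b * R b) ≡ P + c v * D
    at-X = begin
      ∑ X (λ b → t b * R b)
        ≡⟨ ∑-cong X (λ {b} b∈ → trans (cong (t b *_) (at-b b∈)) (distrib (t b) _ (c v) (g b b))) ⟩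
      ∑ X (λ b → t b * ∑ X (λ j → A v j * g j b) + c v * (t b * g b b))
        ≡⟨ trans (∑-+ X _ _) (cong₂ _+_ (∑-cong X λ {b} _ → sym (∑-*ˡ X (t b) _)) (∑-*ˡ X (c v) _)) ⟩
      ∑ X (λ b → ∑ X λ j → t b * (A v j * g j b)) + c v * D
        ≡⟨ cong (_+ c v * D) (∑-swap X X _) ⟩
      ∑ X (λ j → ∑ X λ b → t b * (A v j * g j b)) + c v * D
        ≡⟨ cong (_+ c v * D) (∑-cong X λ {j} _ → trans
             (∑-cong X λ {b} _ → comm (t b) (A v j) (g j b)) (∑-*ˡ X (A v j) _)) ⟩
      P + c v * D ∎
      where
      opaque
        unfolding _+_
        distrib : ∀ x y z w → x * (y + z * w) ≡ x * y + z * (x * w)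
        distrib = solve-∀ ring
        comm : ∀ x y z → x * (y * z) ≡ y * (x * z)
        comm = solve-∀ ring

  eliminate : ∀ {v vs} → Unique (r ∷ v ∷ vs) → ∀ W (s⁻¹ : ℚ) →
              let s = ∑ (r ∷ vs) (W v) in s * s⁻¹ ≡ 1ℚ →
              arb r (v ∷ vs) W ≡ s * arb r vs (λ i j → W i j + W i v * s⁻¹ * W v j)
  eliminate {v} {vs} un W s⁻¹ inverse = sym (begin
    s * arb r vs (λ i j → W i j + W i v * s⁻¹ * W v j)
      ≡⟨ cong (s *_) (arb-cong vs λ {i} {j} _ _ → cong (W i j +_) (*-assoc (W i v) s⁻¹ (W v j))) ⟩
    s * arb r vs (W ⊕ (λ i → W i v) ⊗ t)
      ≡⟨ cong (s *_) (averaging (tail-unique un) W _ t t≡1) ⟩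
    s * ∑ X (λ b → t b * arb r vs (contract W v b))
      ≡⟨ sym (∑-*ˡ X s _) ⟩
    ∑ X (λ b → s * (t b * arb r vs (contract W v b)))
      ≡⟨ ∑-cong X (λ {b} _ → trans (assoc s s⁻¹ (W v b) _)
           (trans (cong (_* _) inverse) (*-identityˡ _))) ⟩
    arb r (v ∷ vs) W ∎)
    where
    X = r ∷ vs
    s = ∑ X (W v)
    -- The row of `v` normalised to total 1. At this vector `averaging` reproduces the expansion of
    -- `arb` along `v`, up to the factor `s`.
    t : Fin n → ℚ
    t j = s⁻¹ * W v j
    t≡1 : ∑ X t ≡ 1ℚ
    t≡1 = trans (∑-*ˡ X s⁻¹ (W v)) (trans (*-comm s⁻¹ s) inverse)
    opaque
      unfolding _+_
      assoc : ∀ s u w a → s * (u * w * a) ≡ s * u * (w * a)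
      assoc = solve-∀ ring

-- Indicators, and linearity of the count in each row

χ : {P : Set} → Dec P → ℚ
χ P? = if does P? then 1ℚ else 0ℚ

χ-yes : {P : Set} (P? : Dec P) → P → χ P? ≡ 1ℚ
χ-yes P? p rewrite dec-true P? p = refl

χ-no : {P : Set} (P? : Dec P) → ¬ P → χ P? ≡ 0ℚ
χ-no P? ¬p rewrite dec-false P? ¬p = refl

χ-cong : {P Q : Set} (P? : Dec P) (Q? : Dec Q) → (P → Q) → (Q → P) → χ P? ≡ χ Q?
χ-cong P? (yes q) f g = χ-yes P? (g q)
χ-cong P? (no ¬q) f g = χ-no P? (¬q ∘ f)

module _ {n : ℕ} (r : Fin n) where

  -- The expansion uses row `v` once, as the factor for the edge leaving `v`. Contracting an earlier
  -- vertex applies the same column operation to all rows, which preserves the linear relation.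
  arb-linear : ∀ {v vs} → v ∈ vs → Unique vs → ∀ c (A B C : Matrix n) →
               (∀ {i} j → i ≢ v → C i j ≡ A i j) → (∀ {i} j → i ≢ v → C i j ≡ B i j) →
               (∀ j → C v j ≡ A v j + c * B v j) →
               arb r vs C ≡ arb r vs A + c * arb r vs B
  arb-linear {v} {.v ∷ vs} (here refl) (v∉ ∷ _) c A B C C≡A C≡B Cv = begin
    ∑ (r ∷ vs) (λ b → C v b * arb r vs (contract C v b))
      ≡⟨ ∑-cong (r ∷ vs) (λ {b} _ → trans (cong (_* arb r vs (contract C v b)) (Cv b))
           (distribute c (A v b) (B v b) (below b C≡A) (below b C≡B))) ⟩
    ∑ (r ∷ vs) (λ b → A v b * arb r vs (contract A v b) + c * (B v b * arb r vs (contract B v b)))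
      ≡⟨ trans (∑-+ (r ∷ vs) _ _) (cong (arb r (v ∷ vs) A +_) (∑-*ˡ (r ∷ vs) c _)) ⟩
    arb r (v ∷ vs) A + c * arb r (v ∷ vs) B ∎
    where
    below : ∀ b {D} → (∀ {i} j → i ≢ v → C i j ≡ D i j) →
            arb r vs (contract C v b) ≡ arb r vs (contract D v b)
    below b C≡D = arb-cong r vs λ {i} {j} i∈ _ →
      let i≢v = ≢-sym (All.lookup v∉ i∈) in
      cong₂ (λ x y → x + y * δ j b) (C≡D j i≢v) (C≡D v i≢v)
    distribute : ∀ c x y {p q p′} → p ≡ q → p ≡ p′ → (x + c * y) * p ≡ x * q + c * (y * p′)
    distribute c x y {p} refl refl = e c x y p
      where
      opaque
        unfolding _+_
        e : ∀ c x y p → (x + c * y) * p ≡ x * p + c * (y * p)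
        e = solve-∀ ring
  arb-linear {v} {u ∷ vs} (there v∈) (u∉ ∷ un) c A B C C≡A C≡B Cv = begin
    ∑ (r ∷ vs) (λ b → C u b * arb r vs (contract C u b))
      ≡⟨ ∑-cong (r ∷ vs) (λ {b} _ → trans
           (cong (C u b *_) (arb-linear v∈ un c (contract A u b) (contract B u b) (contract C u b)
             (λ j i≢v → cong₂ (λ x y → x + y * δ j b) (C≡A j i≢v) (C≡A u i≢v))
             (λ j i≢v → cong₂ (λ x y → x + y * δ j b) (C≡B j i≢v) (C≡B u i≢v))
             (λ j → trans (cong₂ (λ x y → x + y * δ j b) (Cv j) (Cv u))
                          (regroup (A v j) c (B v j) (A v u) (B v u) (δ j b)))))
           (distribute c (arb r vs (contract A u b)) (arb r vs (contract B u b)) (C≡A b u≢v) (C≡B b u≢v))) ⟩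
    ∑ (r ∷ vs) (λ b → A u b * arb r vs (contract A u b) + c * (B u b * arb r vs (contract B u b)))
      ≡⟨ trans (∑-+ (r ∷ vs) _ _) (cong (arb r (u ∷ vs) A +_) (∑-*ˡ (r ∷ vs) c _)) ⟩
    arb r (u ∷ vs) A + c * arb r (u ∷ vs) B ∎
    where
    u≢v = All.lookup u∉ v∈
    distribute : ∀ c x y {p q p′} → p ≡ q → p ≡ p′ → p * (x + c * y) ≡ q * x + c * (p′ * y)
    distribute c x y {p} refl refl = e c x y p
      where
      opaque
        unfolding _+_
        e : ∀ c x y p → p * (x + c * y) ≡ p * x + c * (p * y)
        e = solve-∀ ring
    opaque
      unfolding _+_
      regroup : ∀ a c b a′ b′ d → a + c * b + (a′ + c * b′) * d ≡ (a + a′ * d) + c * (b + b′ * d)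
      regroup = solve-∀ ring

-- Partial functions as graphs

module _ {n : ℕ} (r : Fin n) where

  data Leads (σ : Fin n → Maybe (Fin n)) : Fin n → Set where
    stop : Leads σ r
    step : ∀ {x y} → σ x ≡ just y → Leads σ y → Leads σ x

  unitRows : (Fin n → Maybe (Fin n)) → Matrix n
  unitRows σ i j = maybe′ (δ j) 0ℚ (σ i)

  private
    -- The counterpart of `contract` for partial functions: arrows into `v` are redirected to its
    -- successor `b`, and this does not change which orbits arrive at `r`.
    module Merge (σ : Fin n → Maybe (Fin n)) {v b : Fin n} (σv : σ v ≡ just b)
                 (r≢v : r ≢ v) (b≢v : b ≢ v) where
      merge : Fin n → Fin n
      merge x = if does (x Finₚ.≟ v) then b else x

      merge-≢ : ∀ {x} → x ≢ v → merge x ≡ x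
      merge-≢ {x} x≢v rewrite dec-false (x Finₚ.≟ v) x≢v = refl

      σ′ : Fin n → Maybe (Fin n)
      σ′ = Maybe.map merge ∘ σ

      merge-leads : ∀ {x} → Leads σ x → Leads σ′ (merge x)
      merge-leads stop = subst (Leads σ′) (sym (merge-≢ r≢v)) stop
      merge-leads (step {x} {y} eq l) with x Finₚ.≟ v
      ... | no _ = step (cong (Maybe.map merge) eq) (merge-leads l)
      ... | yes refl with refl ← trans (sym eq) σv = subst (Leads σ′) (merge-≢ b≢v) (merge-leads l)

      leads-merged : ∀ {x} → Leads σ′ x → Leads σ x
      leads-merged stop = stop
      leads-merged (step {x} eq l) with σ x in σx
      ... | just w with w Finₚ.≟ v
      ...   | yes refl with refl ← eq = step σx (step σv (leads-merged l))
      ...   | no _     with refl ← eq = step σx (leads-merged l)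

  Decides : List (Fin n) → (Fin n → Maybe (Fin n)) → Set
  Decides vs σ =
    (∀ {x} → x ∈ vs → Leads σ x) × arb r vs (unitRows σ) ≡ 1ℚ ⊎
    ¬ (∀ {x} → x ∈ vs → Leads σ x) × arb r vs (unitRows σ) ≡ 0ℚ

  remain : ∀ {x v vs} → x ≢ v → x ∈ r ∷ v ∷ vs → x ∈ r ∷ vs
  remain x≢v (here eq)          = here eq
  remain x≢v (there (here eq))  = ⊥-elim (x≢v eq)
  remain x≢v (there (there x∈)) = there x∈

  row-of : ∀ σ {v m} → σ v ≡ m → ∀ vs → arb r (v ∷ vs) (unitRows σ) ≡
           ∑ (r ∷ vs) λ j → maybe′ (δ j) 0ℚ m * arb r vs (contract (unitRows σ) v j)
  row-of σ refl vs = refl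

  -- Each contraction removes one vertex from the orbits. A cycle shrinks until it is a fixed point,
  -- whose unit entry is on the diagonal and is missed by the sum; a vertex without successor has a
  -- zero row. If neither occurs, every orbit ends at `r` and all factors are 1.
  decides : ∀ vs σ → Unique (r ∷ vs) →
            (∀ {x y} → x ∈ vs → σ x ≡ just y → y ∈ r ∷ vs) → Decides vs σ
  decides []       σ _  _ = inj₁ ((λ ()) , refl)
  decides (v ∷ vs) σ un′@((r≢v ∷ r∉) ∷ v∉ ∷ un) closed = by-successor (σ v) refl
    where
    by-successor : ∀ m → σ v ≡ m → Decides (v ∷ vs) σ
    by-successor nothing σv = inj₂
      ((λ h → blocked (h (here refl))) ,
       trans (row-of σ σv vs) (∑-zero (r ∷ vs) λ _ → zeroˡ _))
      where
      blocked : ¬ Leads σ v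
      blocked stop = r≢v refl
      blocked (step eq _) with () ← trans (sym eq) σv
    by-successor (just b) σv with b Finₚ.≟ v
    ... | yes refl = inj₂
      ((λ h → looping (h (here refl)) refl) ,
       trans (row-of σ σv vs) (∑-zero (r ∷ vs) λ {j} j∈ →
         trans (cong (_* arb r vs (contract (unitRows σ) v j)) (δ-≢ (second-≢ r un′ j∈))) (zeroˡ _)))
      where
      looping : ∀ {x} → Leads σ x → x ≢ v
      looping stop eq = r≢v eq
      looping (step eq l) refl with refl ← trans (sym eq) σv = looping l refl
    ... | no b≢v = conclude (decides vs σ′ (r∉ ∷ un) closed′)
      where
      open Merge σ σv r≢v b≢v
      b∈ = remain b≢v (closed (here refl) σv)
      closed′ : ∀ {x y} → x ∈ vs → σ′ x ≡ just y → y ∈ r ∷ vs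
      closed′ {x} x∈ eq with σ x in σx
      ... | just w with w Finₚ.≟ v
      ...   | yes _  with refl ← eq = b∈
      ...   | no w≢v with refl ← eq = remain w≢v (closed (there x∈) σx)
      contracted : ∀ {i j} → i ∈ vs → j ∈ r ∷ vs → contract (unitRows σ) v b i j ≡ unitRows σ′ i j
      contracted {i} {j} i∈ j∈ with σ i
      ... | nothing = trans (+-identityˡ _) (zeroˡ _)
      ... | just w with w Finₚ.≟ v
      ...   | yes refl = trans (cong₂ (λ x y → x + y * δ j b) (δ-≢ (second-≢ r un′ j∈)) (δ-refl v))
                               (trans (+-identityˡ _) (*-identityˡ _))
      ...   | no w≢v   = trans (cong (λ y → δ j w + y * δ j b) (δ-≢ (≢-sym w≢v)))
                               (trans (cong (δ j w +_) (zeroˡ _)) (+-identityʳ _))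
      value : arb r (v ∷ vs) (unitRows σ) ≡ arb r vs (unitRows σ′)
      value = begin
        arb r (v ∷ vs) (unitRows σ)
          ≡⟨ row-of σ σv vs ⟩
        ∑ (r ∷ vs) (λ j → δ j b * arb r vs (contract (unitRows σ) v j))
          ≡⟨ ∑-δ (r∉ ∷ un) b∈ (λ j → arb r vs (contract (unitRows σ) v j)) ⟩
        arb r vs (contract (unitRows σ) v b)
          ≡⟨ arb-cong r vs contracted ⟩
        arb r vs (unitRows σ′) ∎
      from : (∀ {x} → x ∈ v ∷ vs → Leads σ x) → ∀ {x} → x ∈ vs → Leads σ′ x
      from h x∈ = subst (Leads σ′) (merge-≢ (≢-sym (All.lookup v∉ x∈))) (merge-leads (h (there x∈)))
      to : (∀ {x} → x ∈ vs → Leads σ′ x) → ∀ {x} → x ∈ v ∷ vs → Leads σ x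
      to h (there x∈)  = leads-merged (h x∈)
      to h (here refl) = step σv (leads-r∷vs b∈)
        where
        leads-r∷vs : ∀ {x} → x ∈ r ∷ vs → Leads σ x
        leads-r∷vs (here refl) = stop
        leads-r∷vs (there x∈)  = leads-merged (h x∈)
      conclude : Decides vs σ′ → Decides (v ∷ vs) σ
      conclude (inj₁ (h , eq))  = inj₁ (to h , trans value eq)
      conclude (inj₂ (¬h , eq)) = inj₂ ((λ h → ¬h (from h)) , trans value eq)

-- Expansion of the count over edge sets

module _ {n : ℕ} where

  private V = Fin n

  -- An intermediate state of the expansion: `σ` holds the arcs already chosen, `ends` lists the
  -- edges still undecided, and `T` is a selection among these.
  stateArc : ∀ {k} → (V → Maybe V) → (Fin k → V × V) → Subset k → Rel V 0ℓ
  stateArc σ ends T u v = σ u ≡ just v ⊎ ∃ λ e → e ∈ₛ T × ends e ≡ (u , v)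

  stateArc? : ∀ {k} σ (ends : Fin k → V × V) T → B.Decidable (stateArc σ ends T)
  stateArc? σ ends T u v =
    Maybe-≡-dec Finₚ._≟_ (σ u) (just v) ⊎-dec
    Finₚ.any? (λ e → e ∈ₛ? T ×-dec ×-≡-dec Finₚ._≟_ Finₚ._≟_ (ends e) (u , v))

  walk-map : ∀ {R S : Rel V 0ℓ} → (∀ {u v} → R u v → S u v) → ∀ {u vs w} → Walk R u vs w → Walk S u vs w
  walk-map f []      = []
  walk-map f (s ∷ p) = f s ∷ walk-map f p

  oriented-map : ∀ {R S : Rel V 0ℓ} {r} → (∀ {u v} → R u v → S u v) → (∀ {u v} → S u v → R u v) →
                 Oriented R r → Oriented S r
  oriented-map f g (reach , sink , out) =
    (λ v → let vs , p = reach v in vs , walk-map f p) ,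
    (λ w s → sink w (g s)) ,
    (λ v w w′ s s′ → out v w w′ (g s) (g s′))

  weights : ∀ {k} → (Fin k → V × V) → (Fin k → ℚ) → Matrix n
  weights {zero}  ends a i j = 0ℚ
  weights {suc k} ends a i j =
    weights (ends ∘ suc) (a ∘ suc) i j + a zero * (δ i (proj₁ (ends zero)) * δ j (proj₂ (ends zero)))

  override : (V → Maybe V) → Matrix n → Matrix n
  override σ W i j = maybe′ (δ j) (W i j) (σ i)

  override-at : ∀ σ W {i m} j → σ i ≡ m → override σ W i j ≡ maybe′ (δ j) (W i j) m
  override-at σ W j refl = refl

  assign : (V → Maybe V) → V → V → V → Maybe V
  assign σ u b x = if does (x Finₚ.≟ u) then just b else σ x

  assign-≡ : ∀ σ u b → assign σ u b u ≡ just b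
  assign-≡ σ u b rewrite dec-true (u Finₚ.≟ u) refl = refl

  assign-≢ : ∀ σ u b {x} → x ≢ u → assign σ u b x ≡ σ x
  assign-≢ σ u b {x} x≢u rewrite dec-false (x Finₚ.≟ u) x≢u = refl

weight : ∀ {k} → Subset k → (Fin k → ℚ) → ℚ
weight []            a = 1ℚ
weight (inside  ∷ T) a = a zero * weight T (a ∘ suc)
weight (outside ∷ T) a = weight T (a ∘ suc)

module _ {n : ℕ} {r : Fin n} {L : List (Fin n)} (un : Unique (r ∷ L))
         (complete : ∀ {v} → v ≢ r → v ∈ L) where

  private
    V = Fin n

    r∉L : ∀ {v} → v ∈ L → v ≢ r
    r∉L v∈ = ≢-sym (All.lookup (AllPairs.head un) v∈)

  all-leads⇒oriented : ∀ σ → σ r ≡ nothing → ∀ {ends : Fin 0 → V × V} →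
                       (∀ {x} → x ∈ L → Leads r σ x) → Oriented (stateArc σ ends []) r
  all-leads⇒oriented σ σr {ends} h =
    (λ v → walk (leads v)) ,
    (λ { w (inj₁ eq) → case-nothing eq ; w (inj₂ (() , _)) }) ,
    (λ { v w w′ (inj₁ p) (inj₁ q) → just-injective (trans (sym p) q)
       ; v w w′ (inj₂ (() , _)) _ ; v w w′ _ (inj₂ (() , _)) })
    where
    case-nothing : ∀ {w} → σ r ≢ just w
    case-nothing eq with () ← trans (sym σr) eq
    leads : ∀ v → Leads r σ v
    leads v with v Finₚ.≟ r
    ... | yes refl = stop
    ... | no v≢r   = h (complete v≢r)
    walk : ∀ {v} → Leads r σ v → Reachable (stateArc σ ends []) v r
    walk stop        = [] , []
    walk (step eq l) = let vs , p = walk l in _ , inj₁ eq ∷ p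

  oriented⇒all-leads : ∀ σ {ends : Fin 0 → V × V} → Oriented (stateArc σ ends []) r →
                       ∀ v → Leads r σ v
  oriented⇒all-leads σ (reach , _) v = leads (proj₂ (reach v))
    where
    leads : ∀ {v vs} → Walk (stateArc σ _ []) v vs r → Leads r σ v
    leads []                 = stop
    leads (inj₁ eq ∷ p)      = step eq (leads p)
    leads (inj₂ (() , _) ∷ p)

  -- Each edge leaving a row outside the domain of σ is either put into the tree,
  -- which fixes the row, or deleted.
  expansion : ∀ k (ends : Fin k → V × V) (a : Fin k → ℚ) σ →
              (∀ e e′ → ends e ≡ ends e′ → e ≡ e′) →
              (∀ e → σ (proj₁ (ends e)) ≢ just (proj₂ (ends e))) →
              σ r ≡ nothing →
              arb r L (override σ (weights ends a)) ≡
              ∑ (allSubsets k) λ T → χ (oriented? (stateArc? σ ends T) r) * weight T a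
  expansion zero ends a σ simple fresh σr =
    trans (indicator (decides r L σ un closed))
          (sym (trans (+-identityʳ _) (*-identityʳ _)))
    where
    closed : ∀ {x y} → x ∈ L → σ x ≡ just y → y ∈ r ∷ L
    closed {y = y} _ _ with y Finₚ.≟ r
    ... | yes eq = here eq
    ... | no y≢r = there (complete y≢r)
    indicator : Decides r L σ → arb r L (unitRows r σ) ≡ χ (oriented? (stateArc? σ ends []) r)
    indicator (inj₁ (h , eq))  = trans eq (sym (χ-yes (oriented? _ r) (all-leads⇒oriented σ σr h)))
    indicator (inj₂ (¬h , eq)) =
      trans eq (sym (χ-no (oriented? _ r) (λ o → ¬h (λ {x} _ → oriented⇒all-leads σ o x))))
  expansion (suc k) ends a σ simple fresh σr = begin
    arb r L (override σ (weights ends a))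
      ≡⟨ add-edge (proj₁ (ends zero) Finₚ.≟ r) (σ (proj₁ (ends zero))) refl ⟩
    ∑ (allSubsets k) with-edge + arb r L (override σ W′)
      ≡⟨ cong (∑ (allSubsets k) with-edge +_) (expansion k ends′ a′ σ simple′ (fresh ∘ suc) σr) ⟩
    ∑ (allSubsets k) with-edge + ∑ (allSubsets k) (λ T → χ (oriented? (stateArc? σ ends′ T) r) * weight T a′)
      ≡⟨ cong (∑ (allSubsets k) with-edge +_) (∑-cong (allSubsets k) λ {T} _ → cong (_* weight T a′)
           (χ-cong (oriented? (stateArc? σ ends′ T) r) (oriented? (stateArc? σ ends (outside ∷ T)) r)
             (oriented-map (drop-edge⁻¹ T) (drop-edge T)) (oriented-map (drop-edge T) (drop-edge⁻¹ T)))) ⟩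
    ∑ (allSubsets k) with-edge + ∑ (allSubsets k) (term ∘ (outside ∷_))
      ≡⟨ sym (cong₂ _+_ (∑-map (inside ∷_) (allSubsets k) term) (∑-map (outside ∷_) (allSubsets k) term)) ⟩
    ∑ (map (inside ∷_) (allSubsets k)) term + ∑ (map (outside ∷_) (allSubsets k)) term
      ≡⟨ sym (∑-++ (map (inside ∷_) (allSubsets k)) _ term) ⟩
    ∑ (allSubsets (suc k)) term ∎
    where
    ends′ = ends ∘ suc
    a′ = a ∘ suc
    u = proj₁ (ends zero)
    b = proj₂ (ends zero)
    W′ = weights ends′ a′
    simple′ : ∀ e e′ → ends′ e ≡ ends′ e′ → e ≡ e′
    simple′ e e′ eq = Finₚ.suc-injective (simple (suc e) (suc e′) eq)
    term : Subset (suc k) → ℚ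
    term T = χ (oriented? (stateArc? σ ends T) r) * weight T a
    with-edge : Subset k → ℚ
    with-edge T = term (inside ∷ T)

    drop-edge : ∀ T {x y} → stateArc σ ends (outside ∷ T) x y → stateArc σ ends′ T x y
    drop-edge T (inj₁ eq) = inj₁ eq
    drop-edge T (inj₂ (suc e , e∈ , eq)) = inj₂ (e , drop-there e∈ , eq)
    drop-edge⁻¹ : ∀ T {x y} → stateArc σ ends′ T x y → stateArc σ ends (outside ∷ T) x y
    drop-edge⁻¹ T (inj₁ eq) = inj₁ eq
    drop-edge⁻¹ T (inj₂ (e , e∈ , eq)) = inj₂ (suc e , there e∈ , eq)

    off-row : ∀ {i} j → i ≢ u → weights ends a i j ≡ W′ i j
    off-row {i} j i≢u = trans
      (cong (λ d → W′ i j + a zero * (d * δ j b)) (δ-≢ i≢u)) (e (W′ i j) (a zero) (δ j b))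
      where
      opaque
        unfolding _+_
        e : ∀ w x y → w + x * (0ℚ * y) ≡ w
        e = solve-∀ ring

    override-cong : ∀ τ {i} j → (τ i ≡ nothing → weights ends a i j ≡ W′ i j) →
                    override τ (weights ends a) i j ≡ override τ W′ i j
    override-cong τ {i} j eq with τ i
    ... | just _  = refl
    ... | nothing = eq refl

    -- For an edge that leaves `r` or a row decided by `σ`: no oriented selection contains it, and
    -- its weight sits in a row that is never read or is overridden.
    useless : (∀ T → ¬ Oriented (stateArc σ ends (inside ∷ T)) r) → (∀ {i} j → i ∈ L → σ i ≡ nothing → i ≢ u) →
              arb r L (override σ (weights ends a)) ≡ ∑ (allSubsets k) with-edge + arb r L (override σ W′)
    useless ¬o off = trans
      (arb-cong r L λ {i} {j} i∈ _ → override-cong σ j λ σi → off-row j (off j i∈ σi))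
      (sym (trans (cong (_+ arb r L (override σ W′)) (∑-zero (allSubsets k) λ {T} _ →
                     trans (cong (_* weight (inside ∷ T) a) (χ-no (oriented? _ r) (¬o T))) (zeroˡ _)))
                  (+-identityˡ _)))

    add-edge : Dec (u ≡ r) → ∀ m → σ u ≡ m →
      arb r L (override σ (weights ends a)) ≡ ∑ (allSubsets k) with-edge + arb r L (override σ W′)
    add-edge (yes u≡r) _ _ = useless
      (λ { T (_ , sink , _) → sink b (inj₂ (zero , here , cong (_, b) u≡r)) })
      (λ _ i∈ _ i≡u → r∉L i∈ (trans i≡u u≡r))
    -- With two arcs leaving `u`, single-valuedness would identify the edge with the arc stored in
    -- `σ`, which `fresh` forbids.
    add-edge (no _) (just b′) σu = useless
      (λ { T (_ , _ , out) → fresh zero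
             (trans σu (cong just (out u b′ b (inj₁ σu) (inj₂ (zero , here , refl))))) })
      (λ { _ _ σi refl → just≢nothing (trans (sym σu) σi) })
      where
      just≢nothing : just b′ ≢ nothing
      just≢nothing ()
    add-edge (no u≢r) nothing σu = begin
      arb r L (override σ (weights ends a))
        ≡⟨ arb-linear r (complete u≢r) (AllPairs.tail un) (a zero) _ _ _ away away′ at-u ⟩
      arb r L (override σ W′) + a zero * arb r L (override σ′ W′)
        ≡⟨ trans (+-comm _ _) (cong (λ s → a zero * s + arb r L (override σ W′))
             (expansion k ends′ a′ σ′ simple′ fresh′ σ′r)) ⟩
      a zero * ∑ (allSubsets k) (λ T → χ (oriented? (stateArc? σ′ ends′ T) r) * weight T a′) + _
        ≡⟨ cong (_+ arb r L (override σ W′)) (sym (∑-*ˡ (allSubsets k) (a zero) _)) ⟩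
      ∑ (allSubsets k) (λ T → a zero * (χ (oriented? (stateArc? σ′ ends′ T) r) * weight T a′)) + arb r L (override σ W′)
        ≡⟨ cong (_+ arb r L (override σ W′)) (∑-cong (allSubsets k) λ {T} _ → trans (exchange (a zero) _ (weight T a′))
             (cong (_* weight (inside ∷ T) a)
               (χ-cong (oriented? (stateArc? σ′ ends′ T) r) (oriented? (stateArc? σ ends (inside ∷ T)) r)
                 (oriented-map (release T) (fix T)) (oriented-map (fix T) (release T))))) ⟩
      ∑ (allSubsets k) with-edge + arb r L (override σ W′) ∎
      where
      σ′ = assign σ u b
      opaque
        unfolding _+_
        exchange : ∀ x y z → x * (y * z) ≡ y * (x * z)
        exchange = solve-∀ ring
      away : ∀ {i} j → i ≢ u → override σ (weights ends a) i j ≡ override σ W′ i j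
      away j i≢u = override-cong σ j λ _ → off-row j i≢u
      away′ : ∀ {i} j → i ≢ u → override σ (weights ends a) i j ≡ override σ′ W′ i j
      away′ {i} j i≢u rewrite assign-≢ σ u b i≢u = away j i≢u
      at-u : ∀ j → override σ (weights ends a) u j ≡ override σ W′ u j + a zero * override σ′ W′ u j
      at-u j = trans (override-at σ (weights ends a) j σu) (cong₂ (λ w d → w + a zero * d)
        (sym (override-at σ W′ j σu))
        (trans (trans (cong (_* δ j b) (δ-refl u)) (*-identityˡ _))
               (sym (override-at σ′ W′ j (assign-≡ σ u b)))))
      σ′r : σ′ r ≡ nothing
      σ′r = trans (assign-≢ σ u b (≢-sym u≢r)) σr
      -- Only an edge parallel to the one just chosen could violate this, and `simple` excludes it.
      fresh′ : ∀ e → σ′ (proj₁ (ends′ e)) ≢ just (proj₂ (ends′ e))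
      fresh′ e eq with proj₁ (ends′ e) Finₚ.≟ u
      ... | no _  = fresh (suc e) eq
      ... | yes p with () ← simple (suc e) zero (cong₂ _,_ p (sym (just-injective eq)))
      fix : ∀ T {x y} → stateArc σ ends (inside ∷ T) x y → stateArc σ′ ends′ T x y
      fix T {x} (inj₁ eq) = inj₁ (trans (assign-≢ σ u b λ { refl → nothing≢just (trans (sym σu) eq) }) eq)
        where
        nothing≢just : ∀ {y : V} → nothing ≢ just y
        nothing≢just ()
      fix T (inj₂ (zero , _ , refl))     = inj₁ (assign-≡ σ u b)
      fix T (inj₂ (suc e , e∈ , eq)) = inj₂ (e , drop-there e∈ , eq)
      release : ∀ T {x y} → stateArc σ′ ends′ T x y → stateArc σ ends (inside ∷ T) x y
      release T {x} (inj₁ eq) with x Finₚ.≟ u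
      ... | no _  = inj₁ eq
      ... | yes refl = inj₂ (zero , here , cong (u ,_) (just-injective eq))
      release T (inj₂ (e , e∈ , eq)) = inj₂ (suc e , there e∈ , eq)

-- Evaluation at positive integers

-- The value of the variable i at a is 1 + aᵢ.
Point : ℕ → Set
Point = Vec ℕ

evalᴹ : ∀ {m} → Monomial m → Point m → ℕ
evalᴹ []      []      = 1
evalᴹ (k ∷ μ) (x ∷ a) = suc x ℕ.^ k ℕ.* evalᴹ μ a

eval : ∀ {m} → Poly m → Point m → ℤ
eval []            a = ℤ.0ℤ
eval ((c , μ) ∷ p) a = c ℤ.* ℤ.+ evalᴹ μ a ℤ.+ eval p a

evalᴹ-* : ∀ {m} (μ ν : Monomial m) a → evalᴹ (Vec.zipWith ℕ._+_ μ ν) a ≡ evalᴹ μ a ℕ.* evalᴹ ν a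
evalᴹ-* []      []      []      = refl
evalᴹ-* (k ∷ μ) (l ∷ ν) (x ∷ a) = trans
  (cong₂ ℕ._*_ (ℕₚ.^-distribˡ-+-* (suc x) k l) (evalᴹ-* μ ν a))
  (ℕₚ.[m*n]*[o*p]≡[m*o]*[n*p] (suc x ℕ.^ k) (suc x ℕ.^ l) (evalᴹ μ a) (evalᴹ ν a))

evalᴹ-1 : ∀ {m} (a : Point m) → evalᴹ (Vec.replicate _ 0) a ≡ 1
evalᴹ-1 []      = refl
evalᴹ-1 (x ∷ a) = trans (ℕₚ.*-identityˡ _) (evalᴹ-1 a)

evalᴹ-var : ∀ {m} (i : Fin m) a → evalᴹ (Vec.updateAt (Vec.replicate _ 0) i suc) a ≡ suc (Vec.lookup a i)
evalᴹ-var zero    (x ∷ a) = trans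
  (cong₂ ℕ._*_ (ℕₚ.*-identityʳ (suc x)) (evalᴹ-1 a)) (ℕₚ.*-identityʳ (suc x))
evalᴹ-var (suc i) (x ∷ a) = trans (ℕₚ.*-identityˡ _) (evalᴹ-var i a)

eval-const : ∀ {m} c (a : Point m) → eval (constᴾ c) a ≡ c
eval-const c a = begin
  c ℤ.* ℤ.+ evalᴹ (Vec.replicate _ 0) a ℤ.+ ℤ.0ℤ  ≡⟨ ℤₚ.+-identityʳ _ ⟩
  c ℤ.* ℤ.+ evalᴹ (Vec.replicate _ 0) a           ≡⟨ cong (λ e → c ℤ.* ℤ.+ e) (evalᴹ-1 a) ⟩
  c ℤ.* ℤ.1ℤ                                      ≡⟨ ℤₚ.*-identityʳ c ⟩
  c                                               ∎

eval-var : ∀ {m} i (a : Point m) → eval (varᴾ i) a ≡ ℤ.+ suc (Vec.lookup a i)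
eval-var i a = trans (ℤₚ.+-identityʳ _) (trans (ℤₚ.*-identityˡ _) (cong ℤ.+_ (evalᴹ-var i a)))

eval-+ : ∀ {m} p q (a : Point m) → eval (p +ᴾ q) a ≡ eval p a ℤ.+ eval q a
eval-+ []            q a = sym (ℤₚ.+-identityˡ _)
eval-+ ((c , μ) ∷ p) q a = trans
  (cong (λ e → c ℤ.* ℤ.+ evalᴹ μ a ℤ.+ e) (eval-+ p q a))
  (sym (ℤₚ.+-assoc (c ℤ.* ℤ.+ evalᴹ μ a) (eval p a) (eval q a)))

eval-neg : ∀ {m} p (a : Point m) → eval (-ᴾ p) a ≡ ℤ.- eval p a
eval-neg []            a = refl
eval-neg ((c , μ) ∷ p) a = trans (cong (λ e → ℤ.- c ℤ.* ℤ.+ evalᴹ μ a ℤ.+ e) (eval-neg p a))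
                                 (negate c (ℤ.+ evalᴹ μ a) (eval p a))
  where
  negate : ∀ c e f → ℤ.- c ℤ.* e ℤ.+ ℤ.- f ≡ ℤ.- (c ℤ.* e ℤ.+ f)
  negate = solve-∀ᶻ

eval-* : ∀ {m} p q (a : Point m) → eval (p *ᴾ q) a ≡ eval p a ℤ.* eval q a
eval-* []            q a = sym (ℤₚ.*-zeroˡ (eval q a))
eval-* ((c , μ) ∷ p) q a = begin
  eval (map times q ++ (p *ᴾ q)) a
    ≡⟨ eval-+ (map times q) (p *ᴾ q) a ⟩
  eval (map times q) a ℤ.+ eval (p *ᴾ q) a
    ≡⟨ cong₂ ℤ._+_ (eval-times q) (eval-* p q a) ⟩
  c ℤ.* ℤ.+ evalᴹ μ a ℤ.* eval q a ℤ.+ eval p a ℤ.* eval q a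
    ≡⟨ sym (ℤₚ.*-distribʳ-+ (eval q a) (c ℤ.* ℤ.+ evalᴹ μ a) (eval p a)) ⟩
  (c ℤ.* ℤ.+ evalᴹ μ a ℤ.+ eval p a) ℤ.* eval q a ∎
  where
  times : _ → _
  times (d , ν) = c ℤ.* d , Vec.zipWith ℕ._+_ μ ν
  regroup : ∀ c d e f g → c ℤ.* d ℤ.* (e ℤ.* f) ℤ.+ c ℤ.* e ℤ.* g ≡ c ℤ.* e ℤ.* (d ℤ.* f ℤ.+ g)
  regroup = solve-∀ᶻ
  eval-times : ∀ q → eval (map times q) a ≡ c ℤ.* ℤ.+ evalᴹ μ a ℤ.* eval q a
  eval-times []            = sym (ℤₚ.*-zeroʳ (c ℤ.* ℤ.+ evalᴹ μ a))
  eval-times ((d , ν) ∷ q) = trans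
    (cong₂ (λ e f → c ℤ.* d ℤ.* e ℤ.+ f)
      (trans (cong ℤ.+_ (evalᴹ-* μ ν a)) (ℤₚ.pos-* (evalᴹ μ a) (evalᴹ ν a))) (eval-times q))
    (regroup c d (ℤ.+ evalᴹ μ a) (ℤ.+ evalᴹ ν a) (eval q a))

-- p = low p + x₀ · high p.
low : ∀ {m} → Poly (suc m) → Poly m
low []                    = []
low ((c , zero  ∷ μ) ∷ p) = (c , μ) ∷ low p
low ((c , suc k ∷ μ) ∷ p) = low p

high : ∀ {m} → Poly (suc m) → Poly (suc m)
high []                    = []
high ((c , zero  ∷ μ) ∷ p) = high p
high ((c , suc k ∷ μ) ∷ p) = (c , k ∷ μ) ∷ high p

eval-split : ∀ {m} p x (a : Point m) →
             eval p (x ∷ a) ≡ eval (low p) a ℤ.+ ℤ.+ suc x ℤ.* eval (high p) (x ∷ a)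
eval-split []                    x a = sym (trans (ℤₚ.+-identityˡ _) (ℤₚ.*-zeroʳ (ℤ.+ suc x)))
eval-split ((c , zero  ∷ μ) ∷ p) x a = trans
  (cong₂ (λ e f → c ℤ.* ℤ.+ e ℤ.+ f) (ℕₚ.*-identityˡ (evalᴹ μ a)) (eval-split p x a))
  (sym (ℤₚ.+-assoc (c ℤ.* ℤ.+ evalᴹ μ a) (eval (low p) a) _))
eval-split ((c , suc k ∷ μ) ∷ p) x a = trans
  (cong₂ (λ e f → c ℤ.* e ℤ.+ f)
    (trans (cong ℤ.+_ (ℕₚ.*-assoc (suc x) (suc x ℕ.^ k) (evalᴹ μ a)))
           (ℤₚ.pos-* (suc x) (suc x ℕ.^ k ℕ.* evalᴹ μ a)))
    (eval-split p x a))
  (regroup c (ℤ.+ suc x) _ (eval (low p) a) (eval (high p) (x ∷ a)))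
  where
  regroup : ∀ c x e f g → c ℤ.* (x ℤ.* e) ℤ.+ (f ℤ.+ x ℤ.* g) ≡ f ℤ.+ x ℤ.* (c ℤ.* e ℤ.+ g)
  regroup = solve-∀ᶻ

termAt : ∀ {m} → ℤ → Monomial m → Monomial m → ℤ
termAt c ν μ = if does (Vec-≡-dec ℕₚ._≟_ ν μ) then c else ℤ.0ℤ

coeff-low : ∀ {m} p (μ : Monomial m) → coeff p (0 ∷ μ) ≡ coeff (low p) μ
coeff-low []                    μ = refl
coeff-low ((c , zero  ∷ ν) ∷ p) μ = cong (λ e → termAt c ν μ ℤ.+ e) (coeff-low p μ)
coeff-low ((c , suc k ∷ ν) ∷ p) μ = trans (ℤₚ.+-identityˡ _) (coeff-low p μ)

coeff-high : ∀ {m} p k (μ : Monomial m) → coeff p (suc k ∷ μ) ≡ coeff (high p) (k ∷ μ)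
coeff-high []                    k μ = refl
coeff-high ((c , zero  ∷ ν) ∷ p) k μ = trans (ℤₚ.+-identityˡ _) (coeff-high p k μ)
coeff-high ((c , suc l ∷ ν) ∷ p) k μ = cong (λ e → termAt c (l ∷ ν) (k ∷ μ) ℤ.+ e) (coeff-high p k μ)

-- The constant term is divisible by every positive integer.
low-vanishes : ∀ {m} p → (∀ a → eval p a ≡ ℤ.0ℤ) → ∀ (a : Point m) → eval (low p) a ≡ ℤ.0ℤ
low-vanishes p p≡0 a = ℤₚ.∣i∣≡0⇒i≡0 (zero-of-divisible divides)
  where
  c = eval (low p) a
  -- The first variable takes the value `suc x`, which divides `c` and exceeds its absolute value,
  -- so `c` is 0.
  x = ℤ.∣ c ∣
  h = eval (high p) (x ∷ a)
  c≡ : c ≡ ℤ.+ suc x ℤ.* (ℤ.- h)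
  c≡ = begin
    c                                                  ≡⟨ isolate c (ℤ.+ suc x) h ⟩
    c ℤ.+ ℤ.+ suc x ℤ.* h ℤ.+ ℤ.+ suc x ℤ.* (ℤ.- h)   ≡⟨ cong (ℤ._+ ℤ.+ suc x ℤ.* (ℤ.- h)) (trans (sym (eval-split p x a)) (p≡0 (x ∷ a))) ⟩
    ℤ.0ℤ ℤ.+ ℤ.+ suc x ℤ.* (ℤ.- h)                    ≡⟨ ℤₚ.+-identityˡ _ ⟩
    ℤ.+ suc x ℤ.* (ℤ.- h)                             ∎
    where
    isolate : ∀ c x h → c ≡ c ℤ.+ x ℤ.* h ℤ.+ x ℤ.* (ℤ.- h)
    isolate = solve-∀ᶻ
  divides : suc x ℕ∣.∣ x
  divides = ℕ∣.divides ℤ.∣ ℤ.- h ∣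
    (trans (cong ℤ.∣_∣ c≡) (trans (ℤₚ.abs-* (ℤ.+ suc x) (ℤ.- h)) (ℕₚ.*-comm (suc x) _)))
  zero-of-divisible : ∀ {y} → suc y ℕ∣.∣ y → y ≡ 0
  zero-of-divisible {zero}  _ = refl
  zero-of-divisible {suc y} d = ⊥-elim (ℕₚ.<-irrefl refl (ℕ∣.∣⇒≤ d))

high-vanishes : ∀ {m} p → (∀ a → eval p a ≡ ℤ.0ℤ) → ∀ (a : Point (suc m)) → eval (high p) a ≡ ℤ.0ℤ
high-vanishes p p≡0 (x ∷ a) = cancel (ℤₚ.i*j≡0⇒i≡0∨j≡0 (ℤ.+ suc x) (begin
  ℤ.+ suc x ℤ.* eval (high p) (x ∷ a)                       ≡⟨ sym (ℤₚ.+-identityˡ _) ⟩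
  ℤ.0ℤ ℤ.+ ℤ.+ suc x ℤ.* eval (high p) (x ∷ a)             ≡⟨ cong (ℤ._+ ℤ.+ suc x ℤ.* eval (high p) (x ∷ a)) (sym (low-vanishes p p≡0 a)) ⟩
  eval (low p) a ℤ.+ ℤ.+ suc x ℤ.* eval (high p) (x ∷ a)   ≡⟨ sym (eval-split p x a) ⟩
  eval p (x ∷ a)                                            ≡⟨ p≡0 (x ∷ a) ⟩
  ℤ.0ℤ                                                      ∎))
  where
  cancel : ∀ {y} → ℤ.+ suc x ≡ ℤ.0ℤ ⊎ y ≡ ℤ.0ℤ → y ≡ ℤ.0ℤ
  cancel (inj₂ eq) = eq

-- Both the part of `p` free of the first variable and the quotient of the rest by that variable
-- vanish at all points, so the exponent vector can be lowered one unit at a time.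
coeff-vanishes : ∀ {m} (μ : Monomial m) p → (∀ a → eval p a ≡ ℤ.0ℤ) → coeff p μ ≡ ℤ.0ℤ
coeff-vanishes []          p p≡0 = trans (coeff-[] p) (p≡0 [])
  where
  coeff-[] : ∀ p → coeff p [] ≡ eval p []
  coeff-[] []             = refl
  coeff-[] ((c , []) ∷ p) = cong₂ ℤ._+_ (sym (ℤₚ.*-identityʳ c)) (coeff-[] p)
coeff-vanishes (zero  ∷ μ) p p≡0 = trans (coeff-low p μ) (coeff-vanishes μ (low p) (low-vanishes p p≡0))
coeff-vanishes (suc k ∷ μ) p p≡0 = trans (coeff-high p k μ) (coeff-vanishes (k ∷ μ) (high p) (high-vanishes p p≡0))

coeff-+ : ∀ {m} p q (μ : Monomial m) → coeff (p +ᴾ q) μ ≡ coeff p μ ℤ.+ coeff q μ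
coeff-+ []            q μ = sym (ℤₚ.+-identityˡ _)
coeff-+ ((c , ν) ∷ p) q μ = trans (cong (λ e → termAt c ν μ ℤ.+ e) (coeff-+ p q μ))
  (sym (ℤₚ.+-assoc (termAt c ν μ) (coeff p μ) (coeff q μ)))

coeff-neg : ∀ {m} p (μ : Monomial m) → coeff (-ᴾ p) μ ≡ ℤ.- coeff p μ
coeff-neg []            μ = refl
coeff-neg ((c , ν) ∷ p) μ = trans
  (cong₂ ℤ._+_ (negate-if (does (Vec-≡-dec ℕₚ._≟_ ν μ))) (coeff-neg p μ))
  (sym (ℤₚ.neg-distrib-+ (termAt c ν μ) (coeff p μ)))
  where
  negate-if : ∀ b → (if b then ℤ.- c else ℤ.0ℤ) ≡ ℤ.- (if b then c else ℤ.0ℤ)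
  negate-if true  = refl
  negate-if false = refl

eval-injective : ∀ {m} (p q : Poly m) → (∀ a → eval p a ≡ eval q a) → p ≈ᴾ q
eval-injective p q eq μ = ℤₚ.i-j≡0⇒i≡j (coeff p μ) (coeff q μ) (begin
  coeff p μ ℤ.- coeff q μ          ≡⟨ cong (λ e → coeff p μ ℤ.+ e) (sym (coeff-neg q μ)) ⟩
  coeff p μ ℤ.+ coeff (-ᴾ q) μ     ≡⟨ sym (coeff-+ p (-ᴾ q) μ) ⟩
  coeff (p +ᴾ (-ᴾ q)) μ            ≡⟨ coeff-vanishes μ (p +ᴾ (-ᴾ q)) (λ a → begin
    eval (p +ᴾ (-ᴾ q)) a             ≡⟨ eval-+ p (-ᴾ q) a ⟩
    eval p a ℤ.+ eval (-ᴾ q) a       ≡⟨ cong₂ ℤ._+_ (eq a) (eval-neg q a) ⟩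
    eval q a ℤ.- eval q a            ≡⟨ ℤₚ.+-inverseʳ (eval q a) ⟩
    ℤ.0ℤ                             ∎) ⟩
  ℤ.0ℤ                             ∎)

-- Integers inside the rationals

opaque
  unfolding _+_

  -- Built in lowest terms with denominator 1, so that the integer is recovered by projecting the
  -- numerator.
  ι : ℤ → ℚ
  ι i = ℚ.mkℚ i 0 (Coprimality.sym (Coprimality.1-coprimeTo ℤ.∣ i ∣))

  ι-+ : ∀ i j → ι (i ℤ.+ j) ≡ ι i + ι j
  ι-+ i j = ℚₚ.toℚᵘ-injective (ℚᵘₚ.≃-trans (ℚᵘ.*≡* (numerators i j))
    (ℚᵘₚ.≃-sym (ℚₚ.toℚᵘ-homo-+ (ι i) (ι j))))
    where
    numerators : ∀ i j → (i ℤ.+ j) ℤ.* ℤ.1ℤ ≡ (i ℤ.* ℤ.1ℤ ℤ.+ j ℤ.* ℤ.1ℤ) ℤ.* ℤ.1ℤ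
    numerators = solve-∀ᶻ

  ι-* : ∀ i j → ι (i ℤ.* j) ≡ ι i * ι j
  ι-* i j = ℚₚ.toℚᵘ-injective (ℚᵘₚ.≃-trans (ℚᵘ.*≡* refl)
    (ℚᵘₚ.≃-sym (ℚₚ.toℚᵘ-homo-* (ι i) (ι j))))

  ι-injective : ∀ {i j} → ι i ≡ ι j → i ≡ j
  ι-injective eq = cong ℚ.ℚ.numerator eq

  ι-0 : ι ℤ.0ℤ ≡ 0ℚ
  ι-0 = refl

  ι-1 : ι ℤ.1ℤ ≡ 1ℚ
  ι-1 = refl

-- Relations oriented towards a root

module _ {n : ℕ} {R : Rel (Fin n) 0ℓ} where

  reach-trans : ∀ {u v w} → Reachable R u v → Reachable R v w → Reachable R u w
  reach-trans (_ , [])    q = q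
  reach-trans (_ , s ∷ p) q = let vs , p′ = reach-trans (_ , p) q in _ , s ∷ p′

  reach-sym : (∀ {u v} → R u v → R v u) → ∀ {u v} → Reachable R u v → Reachable R v u
  reach-sym R-sym (_ , [])    = _ , []
  reach-sym R-sym (_ , s ∷ p) = reach-trans (reach-sym R-sym (_ , p)) (_ , R-sym s ∷ [])

  end-∈ : ∀ {u v vs w} → Walk R u (v ∷ vs) w → w ∈ v ∷ vs
  end-∈ (s ∷ [])         = here refl
  end-∈ (s ∷ p@(_ ∷ _))  = there (end-∈ p)

  reach-from : ∀ {u vs w x} → Walk R u vs w → x ∈ u ∷ vs → Reachable R x w
  reach-from p       (here refl) = _ , p
  reach-from (_ ∷ p) (there x∈)  = reach-from p x∈

module OrientedProperties {n : ℕ} {R : Rel (Fin n) 0ℓ} {r : Fin n} (o : Oriented R r) where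

  private
    sink = proj₁ (proj₂ o)
    out  = proj₂ (proj₂ o)

  distance : Fin n → ℕ
  distance v = length (proj₁ (oriented⇒unique R o v))

  distance-step : ∀ {u v} → R u v → distance u ≡ suc (distance v)
  distance-step {u} {v} s =
    let _ , p , _ = oriented⇒unique R o v
        _ , _ , unique = oriented⇒unique R o u
    in cong length (unique (s ∷ p))

  asymmetric : ∀ {u v} → R u v → ¬ R v u
  asymmetric s t = ℕₚ.<-irrefl refl
    (ℕₚ.≤-trans (ℕₚ.≤-reflexive (sym (distance-step s))) (ℕₚ.≤-trans (ℕₚ.n≤1+n _) (ℕₚ.≤-reflexive (sym (distance-step t)))))

  private
    Either : Rel (Fin n) 0ℓ
    Either u v = R u v ⊎ R v u

  -- A path that has moved away from r once can only keep moving away.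
  descend : ∀ {x y vs w} → R y x → Walk Either y vs w → Unique (x ∷ y ∷ vs) →
            distance x < distance w × ∃ λ z → z ∈ x ∷ y ∷ vs × R w z
  descend y→x [] _ = ℕₚ.≤-reflexive (sym (distance-step y→x)) , _ , here refl , y→x
  descend y→x (inj₁ y→z ∷ p) ((_ ∷ x≢z ∷ _) ∷ _) = ⊥-elim (x≢z (out _ _ _ y→x y→z))
  descend y→x (inj₂ z→y ∷ p) (_ ∷ un) =
    let y<w , z , z∈ , w→z = descend z→y p un
    in ℕₚ.<-trans (ℕₚ.≤-reflexive (sym (distance-step y→x))) y<w , z , there z∈ , w→z

  -- A path in the underlying graph runs towards `r` and then possibly away from it. Without a turn
  -- its end is nearer to `r` than its start; after a turn, `descend` yields an arc from its end
  -- back into the path.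
  path-end : ∀ {y z vs w} → Walk Either y (z ∷ vs) w → Unique (y ∷ z ∷ vs) →
             distance w < distance y ⊎ ∃ λ x → x ∈ y ∷ z ∷ vs × R w x
  path-end (inj₂ z→y ∷ p) un = inj₂ (proj₂ (descend z→y p un))
  path-end (inj₁ y→z ∷ []) _ = inj₁ (ℕₚ.≤-reflexive (sym (distance-step y→z)))
  path-end (inj₁ y→z ∷ p@(_ ∷ _)) (_ ∷ un) with path-end p un
  ... | inj₁ w<z           = inj₁ (ℕₚ.<-trans w<z (ℕₚ.≤-reflexive (sym (distance-step y→z))))
  ... | inj₂ (x , x∈ , w→x) = inj₂ (x , there x∈ , w→x)

  -- Split on the directions of the first two edges. Either some vertex has arcs to two different
  -- targets, or the distances to `r` around the cycle contradict each other.
  acyclic : ∀ {u vs} → ¬ IsCycle Either u vs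
  acyclic {vs = _ ∷ []}    (_ , _ , s≤s ())
  acyclic {vs = _ ∷ _ ∷ []} (_ , _ , s≤s (s≤s ()))
  acyclic {u} {v₁ ∷ v₂ ∷ v₃ ∷ vs} (s₁ ∷ s₂ ∷ p , un@(v₁∉ ∷ v₂∉ ∷ un₃) , _) = go s₁ s₂
    where
    v₂≢u : v₂ ≢ u
    v₂≢u = All.lookup v₂∉ (end-∈ p)
    go : Either u v₁ → Either v₁ v₂ → ⊥
    go (inj₂ v₁→u) (inj₁ v₁→v₂) = v₂≢u (out _ _ _ v₁→v₂ v₁→u)
    go (inj₂ v₁→u) (inj₂ v₂→v₁) = ℕₚ.<-asym (proj₁ (descend v₂→v₁ p un))
      (ℕₚ.≤-reflexive (sym (distance-step v₁→u)))
    go (inj₁ u→v₁) s with path-end p (v₂∉ ∷ un₃)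
    ... | inj₂ (x , x∈ , u→x) = All.lookup v₁∉ x∈ (out _ _ _ u→v₁ u→x)
    ... | inj₁ u<v₂ with s
    ...   | inj₁ v₁→v₂ = ℕₚ.<-asym u<v₂
              (ℕₚ.<-trans (ℕₚ.≤-reflexive (sym (distance-step v₁→v₂))) (ℕₚ.≤-reflexive (sym (distance-step u→v₁))))
    ...   | inj₂ v₂→v₁ = ℕₚ.<-irrefl (trans (distance-step u→v₁) (sym (distance-step v₂→v₁))) u<v₂

-- Induction along the walk to `r` in `R`. Suppose `S` reverses the arc from `u` to `y`. If `y` is
-- `r`, an arc of `S` leaves the root. Otherwise the next arc of `R`, leaving `y`, is also in `S` by
-- induction, so it must end at `u`, and `R` contains an arc in both directions.
oriented-unique : ∀ {n} {R S : Rel (Fin n) 0ℓ} {r} → Oriented R r → Oriented S r →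
                  (∀ {u v} → R u v → S u v ⊎ S v u) → ∀ {u v} → R u v → S u v
oriented-unique {R = R} {S} {r} o@(reach , sink , out) o′@(_ , sink′ , out′) either {u} s =
  along (proj₂ (reach u)) s
  where
  along : ∀ {u vs} → Walk R u vs r → ∀ {y} → R u y → S u y
  along [] s = ⊥-elim (sink _ s)
  along (s ∷ p) t with refl ← out _ _ _ s t with either t | p
  ... | inj₁ u→y | _      = u→y
  ... | inj₂ y→u | []     = ⊥-elim (sink′ _ y→u)
  ... | inj₂ y→u | s′ ∷ _ with refl ← out′ _ _ _ y→u (along p s′) =
    ⊥-elim (OrientedProperties.asymmetric o t s′)

module _ {k : ℕ} {P : Pred (Fin k) 0ℓ} (P? : Decidable P) where

  subset : Subset k
  subset = Vec.tabulate (does ∘ P?)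

  ∈-subset⁺ : ∀ {e} → P e → e ∈ₛ subset
  ∈-subset⁺ {e} p = lookup⇒[]= e subset (trans (lookup∘tabulate _ e) (dec-true (P? e) p))

  ∈-subset⁻ : ∀ {e} → e ∈ₛ subset → P e
  ∈-subset⁻ {e} e∈ with P? e | trans (sym (lookup∘tabulate (does ∘ P?) e)) ([]=⇒lookup e∈)
  ... | yes p | _ = p

-- Orientations of spanning trees

module Orientations {n : ℕ} (G : Graph n) (r : Fin n) where

  open Graph G
  private V = Fin n

  Joins : Fin edges → Rel V 0ℓ
  Joins e u v = ends e ≡ (u , v) ⊎ ends e ≡ (v , u)

  joins-sym : ∀ {e u v} → Joins e u v → Joins e v u
  joins-sym = Sum.swap

  joins-≢ : ∀ {e u v} → Joins e u v → u ≢ v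
  joins-≢ {e} (inj₁ eq) u≡v = loopless e (trans (cong proj₁ eq) (trans u≡v (sym (cong proj₂ eq))))
  joins-≢ {e} (inj₂ eq) u≡v = loopless e (trans (cong proj₁ eq) (trans (sym u≡v) (sym (cong proj₂ eq))))

  joins-same : ∀ {e e′ u v} → Joins e u v → Joins e′ u v → e ≡ e′
  joins-same (inj₁ p) (inj₁ q) = simple _ _ (inj₁ (trans p (sym q)))
  joins-same (inj₁ p) (inj₂ q) = simple _ _ (inj₂ (trans p (sym (cong swap q))))
  joins-same (inj₂ p) (inj₁ q) = simple _ _ (inj₂ (trans p (sym (cong swap q))))
  joins-same (inj₂ p) (inj₂ q) = simple _ _ (inj₁ (trans p (sym q)))

  joins-end : ∀ {e u v w} → Joins e u v → Joins e u w → v ≡ w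
  joins-end {e} {u} p q = end p q
    where
    end : ∀ {v w} → Joins e u v → Joins e u w → v ≡ w
    end (inj₁ p) (inj₁ q) = cong proj₂ (trans (sym p) q)
    end (inj₂ p) (inj₂ q) = cong proj₁ (trans (sym p) q)
    end (inj₁ p) (inj₂ q) = ⊥-elim (loopless e (trans (cong proj₁ p) (sym (cong proj₂ q))))
    end (inj₂ p) (inj₁ q) = ⊥-elim (loopless e (trans (cong proj₁ q) (sym (cong proj₂ p))))

  joins-meet : ∀ {e u v x y} → Joins e u v → Joins e x y → u ≡ x ⊎ u ≡ y
  joins-meet (inj₁ p) (inj₁ q) = inj₁ (cong proj₁ (trans (sym p) q))
  joins-meet (inj₁ p) (inj₂ q) = inj₂ (cong proj₁ (trans (sym p) q))
  joins-meet (inj₂ p) (inj₁ q) = inj₂ (cong proj₂ (trans (sym p) q))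
  joins-meet (inj₂ p) (inj₂ q) = inj₁ (cong proj₂ (trans (sym p) q))

  -- An orientation is coded as a pair of edge sets: `T₁` runs as listed in `ends` and `T₂` in
  -- reverse. These are the two halves of an edge set of the bidirected digraph.
  OArc : Subset edges → Subset edges → Rel V 0ℓ
  OArc T₁ T₂ u v = ∃ λ e → e ∈ₛ T₁ × ends e ≡ (u , v) ⊎ e ∈ₛ T₂ × ends e ≡ (v , u)

  module _ {T₁ T₂ : Subset edges} where

    oarc⇒adj : ∀ {u v} → OArc T₁ T₂ u v → Adj G (T₁ ∪ T₂) u v
    oarc⇒adj (e , inj₁ (e∈ , eq)) = e , x∈p∪q⁺ (inj₁ e∈) , inj₁ eq
    oarc⇒adj (e , inj₂ (e∈ , eq)) = e , x∈p∪q⁺ (inj₂ e∈) , inj₂ eq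

    adj⇒oarc : ∀ {u v} → Adj G (T₁ ∪ T₂) u v → OArc T₁ T₂ u v ⊎ OArc T₁ T₂ v u
    adj⇒oarc (e , e∈ , eq) with x∈p∪q⁻ T₁ T₂ e∈ | eq
    ... | inj₁ e∈₁ | inj₁ p = inj₁ (e , inj₁ (e∈₁ , p))
    ... | inj₁ e∈₁ | inj₂ p = inj₂ (e , inj₁ (e∈₁ , p))
    ... | inj₂ e∈₂ | inj₁ p = inj₂ (e , inj₂ (e∈₂ , p))
    ... | inj₂ e∈₂ | inj₂ p = inj₁ (e , inj₂ (e∈₂ , p))

    oriented⇒disjoint : Oriented (OArc T₁ T₂) r → ∀ {e} → e ∈ₛ T₁ → ¬ e ∈ₛ T₂
    oriented⇒disjoint o e∈₁ e∈₂ = OrientedProperties.asymmetric o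
      (_ , inj₁ (e∈₁ , refl)) (_ , inj₂ (e∈₂ , refl))

    oriented⇒spanningTree : Oriented (OArc T₁ T₂) r → IsSpanningTree G (T₁ ∪ T₂)
    oriented⇒spanningTree o@(reach , _) =
      (λ u v → reach-trans (to-root u) (reach-sym adj-sym (to-root v))) ,
      (λ u (vs , p , un , 3≤) →
        OrientedProperties.acyclic o (walk-map adj⇒oarc p , un , 3≤))
      where
      adj-sym : ∀ {u v} → Adj G (T₁ ∪ T₂) u v → Adj G (T₁ ∪ T₂) v u
      adj-sym (e , e∈ , eq) = e , e∈ , joins-sym eq
      to-root : ∀ u → Reachable (Adj G (T₁ ∪ T₂)) u r
      to-root u = let vs , p = reach u in vs , walk-map oarc⇒adj p

  orientation-⊆ : ∀ {T₁ T₂ S₁ S₂} → T₁ ∪ T₂ ≡ S₁ ∪ S₂ →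
                  Oriented (OArc T₁ T₂) r → Oriented (OArc S₁ S₂) r → T₁ ⊆ S₁ × T₂ ⊆ S₂
  orientation-⊆ {T₁} {T₂} {S₁} {S₂} eq o o′ = first , second
    where
    transfer : ∀ {u v} → OArc T₁ T₂ u v → OArc S₁ S₂ u v
    transfer = oriented-unique o o′ λ {u} {v} s →
      adj⇒oarc (subst (λ T → Adj G T u v) eq (oarc⇒adj s))
    first : T₁ ⊆ S₁
    first {e} e∈ with transfer (e , inj₁ (e∈ , refl))
    ... | e′ , inj₁ (e′∈ , p) with refl ← simple e e′ (inj₁ (sym p)) = e′∈
    ... | e′ , inj₂ (e′∈ , p) with refl ← simple e e′ (inj₂ (sym (cong swap p))) =
      ⊥-elim (loopless e (cong proj₁ p))
    second : T₂ ⊆ S₂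
    second {e} e∈ with transfer (e , inj₂ (e∈ , refl))
    ... | e′ , inj₂ (e′∈ , p) with refl ← simple e e′ (inj₁ (sym p)) = e′∈
    ... | e′ , inj₁ (e′∈ , p) with refl ← simple e e′ (inj₂ (sym (cong swap p))) =
      ⊥-elim (loopless e (cong proj₁ p))

  module SpanningTree {T : Subset edges} (tree : IsSpanningTree G T) where

    Except : Fin edges → Rel V 0ℓ
    Except e u v = ∃ λ e′ → e′ ≢ e × e′ ∈ₛ T × Joins e′ u v

    except? : ∀ e → B.Decidable (Except e)
    except? e u v = Finₚ.any? λ e′ → ¬? (e′ Finₚ.≟ e) ×-dec e′ ∈ₛ? T ×-dec
      (×-≡-dec Finₚ._≟_ Finₚ._≟_ (ends e′) (u , v) ⊎-dec ×-≡-dec Finₚ._≟_ Finₚ._≟_ (ends e′) (v , u))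

    except-sym : ∀ {e u v} → Except e u v → Except e v u
    except-sym (e′ , e′≢e , e′∈ , j) = e′ , e′≢e , e′∈ , joins-sym j

    -- A path between the ends that avoids `e` would close up with `e` to a cycle. By simplicity it
    -- has at least two edges, so the cycle has the required length.
    bridge : ∀ {e u v} → e ∈ₛ T → Joins e u v → ¬ Reachable (Except e) u v
    bridge {e} {u} {v} e∈ j (_ , p) with toPath p
    ... | [] , _ , [] = joins-≢ j refl
    ... | _ ∷ [] , _ , (_ , e′≢e , _ , j′) ∷ [] = e′≢e (joins-same j′ j)
    ... | x ∷ y ∷ ws , un , q = proj₂ tree v
      (u ∷ x ∷ y ∷ ws , (e , e∈ , joins-sym j) ∷ walk-map (λ (e′ , _ , e′∈ , j′) → e′ , e′∈ , j′) q ,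
       un , s≤s (s≤s (s≤s z≤n)))

    avoid : ∀ {e u v x vs w} → Joins e u v → All (u ≢_) (x ∷ vs) → Walk (Adj G T) x vs w →
            Walk (Except e) x vs w
    avoid j _ [] = []
    avoid j (u≢x ∷ u≢y ∷ u∉) ((e′ , e′∈ , j′) ∷ p) =
      (e′ , (λ { refl → Sum.[ u≢x , u≢y ]′ (joins-meet j j′) }) , e′∈ , j′) ∷ avoid j (u≢y ∷ u∉) p

    private
      path : ∀ u → ∃ λ ws → Unique (u ∷ ws) × Walk (Adj G T) u ws r
      path u = toPath (proj₂ (proj₁ tree u r))

    -- On a path from `u` to `r` only the first edge can be `e`, since the path does not return to
    -- `u`.
    one-end-reaches : ∀ {e u v} → e ∈ₛ T → Joins e u v →
                      Reachable (Except e) u r ⊎ Reachable (Except e) v r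
    one-end-reaches {e} {u} e∈ j with path u
    ... | [] , _ , [] = inj₁ (_ , [])
    ... | _ ∷ _ , u∉ ∷ _ , (e′ , e′∈ , j′) ∷ p with e′ Finₚ.≟ e
    ...   | no e′≢e  = inj₁ (_ , (e′ , e′≢e , e′∈ , j′) ∷ avoid j u∉ p)
    ...   | yes refl with refl ← joins-end j j′ = inj₂ (_ , avoid j u∉ p)

    -- An edge is oriented towards the end still connected to r after its removal.
    TowardsRoot : Rel V 0ℓ
    TowardsRoot u v = ∃ λ e → e ∈ₛ T × Joins e u v × Reachable (Except e) v r

    towardsRoot-oriented : Oriented TowardsRoot r
    towardsRoot-oriented = (λ v → let _ , un , p = path v in follow un p) , sink , out
      where
      follow : ∀ {v vs} → Unique (v ∷ vs) → Walk (Adj G T) v vs r → Reachable TowardsRoot v r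
      follow _ [] = _ , []
      follow (v∉ ∷ un) ((e , e∈ , j) ∷ p) =
        _ , (e , e∈ , j , _ , avoid j v∉ p) ∷ proj₂ (follow un p)
      sink : ∀ w → ¬ TowardsRoot r w
      sink w (e , e∈ , j , w⇝r) = bridge e∈ (joins-sym j) w⇝r
      out : ∀ v w w′ → TowardsRoot v w → TowardsRoot v w′ → w ≡ w′
      out v w w′ (e , e∈ , j , w⇝r) (e′ , e′∈ , j′ , w′⇝r) with e Finₚ.≟ e′
      ... | yes refl = joins-end j j′
      -- If the path from `w` to the root meets `v`, the ends of `e` are connected without `e`.
      -- Otherwise prefixing `e` gives a route from `v` to the root that avoids `e′`, and the ends
      -- of `e′` are connected without `e′`. Both contradict `bridge`.
      ... | no e≢e′ with toPath (proj₂ w⇝r)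
      ...   | ws , un , q with DecMembership._∈?_ Finₚ._≟_ v (w ∷ ws)
      ...     | yes v∈ = ⊥-elim (bridge e∈ j
                  (reach-trans (reach-from q v∈) (reach-sym except-sym w⇝r)))
      ...     | no v∉  = ⊥-elim (bridge e′∈ j′ (reach-trans
                  (_ , (e , e≢e′ , e∈ , j) ∷ avoid j′ (Allₚ.¬Any⇒All¬ _ v∉)
                         (walk-map (λ (e′ , _ , e′∈ , j′) → e′ , e′∈ , j′) q))
                  (reach-sym except-sym w′⇝r)))

    forward? : Decidable λ e → e ∈ₛ T × Reachable (Except e) (proj₂ (ends e)) r
    forward? e = e ∈ₛ? T ×-dec reachable? (except? e) (proj₂ (ends e)) r

    backward? : Decidable λ e → e ∈ₛ T × Reachable (Except e) (proj₁ (ends e)) r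
    backward? e = e ∈ₛ? T ×-dec reachable? (except? e) (proj₁ (ends e)) r

    forward backward : Subset edges
    forward  = subset forward?
    backward = subset backward?

    forward∪backward : forward ∪ backward ≡ T
    forward∪backward = ⊆-antisym
      (λ e∈ → Sum.[ proj₁ ∘ ∈-subset⁻ forward? , proj₁ ∘ ∈-subset⁻ backward? ]′ (x∈p∪q⁻ forward backward e∈))
      (λ e∈ → x∈p∪q⁺ (Sum.map (λ h → ∈-subset⁺ forward? (e∈ , h)) (λ h → ∈-subset⁺ backward? (e∈ , h))
                (Sum.swap (one-end-reaches e∈ (inj₁ refl)))))

    orientation : Oriented (OArc forward backward) r
    orientation = oriented-map into from towardsRoot-oriented
      where
      into : ∀ {u v} → TowardsRoot u v → OArc forward backward u v
      into (e , e∈ , inj₁ refl , h) = e , inj₁ (∈-subset⁺ forward? (e∈ , h) , refl)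
      into (e , e∈ , inj₂ refl , h) = e , inj₂ (∈-subset⁺ backward? (e∈ , h) , refl)
      from : ∀ {u v} → OArc forward backward u v → TowardsRoot u v
      from (e , inj₁ (e∈ , refl)) = let e∈T , h = ∈-subset⁻ forward? e∈ in e , e∈T , inj₁ refl , h
      from (e , inj₂ (e∈ , refl)) = let e∈T , h = ∈-subset⁻ backward? e∈ in e , e∈T , inj₂ refl , h

    orientation-unique : ∀ {S₁ S₂} → S₁ ∪ S₂ ≡ T → Oriented (OArc S₁ S₂) r →
                         S₁ ≡ forward × S₂ ≡ backward
    orientation-unique eq o =
      let eq′ = trans eq (sym forward∪backward)
          p₁ , p₂ = orientation-⊆ eq′ o orientation
          q₁ , q₂ = orientation-⊆ (sym eq′) orientation o
      in ⊆-antisym p₁ q₁ , ⊆-antisym p₂ q₂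

-- Generating functions

valueAt : ∀ {m} → Point m → Fin m → ℚ
valueAt a i = ι (ℤ.+ suc (lookup a i))

weight-cong : ∀ {k} (T : Subset k) {a b : Fin k → ℚ} → (∀ e → a e ≡ b e) → weight T a ≡ weight T b
weight-cong []            eq = refl
weight-cong (inside  ∷ T) eq = cong₂ _*_ (eq zero) (weight-cong T (eq ∘ suc))
weight-cong (outside ∷ T) eq = weight-cong T (eq ∘ suc)

eval-monomial : ∀ {m} (T : Subset m) a → ι (eval (x^ T) a) ≡ weight T (valueAt a)
eval-monomial {m} T a = along T id (λ e∈ → e∈) (λ e∈ → e∈)
  where
  -- `x^_` filters the list of all variables, whereas `weight` recurses on the subset. The induction
  -- follows a tail of that list through `g`, with `S` the matching tail of `T`.
  along : ∀ {j} (S : Subset j) (g : Fin j → Fin m) →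
          (∀ {i} → i ∈ₛ S → g i ∈ₛ T) → (∀ {i} → g i ∈ₛ T → i ∈ₛ S) →
          ι (eval (prodᴾ (map varᴾ (filter (_∈ₛ? T) (tabulate g)))) a) ≡ weight S (valueAt a ∘ g)
  along []            g to from = trans (cong ι (eval-const ℤ.1ℤ a)) ι-1
  along (inside ∷ S)  g to from = begin
    ι (eval (prodᴾ (map varᴾ (filter (_∈ₛ? T) (tabulate g)))) a)
      ≡⟨ cong (λ es → ι (eval (prodᴾ (map varᴾ es)) a)) (filter-accept (_∈ₛ? T) (to here)) ⟩
    ι (eval (varᴾ (g zero) *ᴾ prodᴾ (map varᴾ rest)) a)
      ≡⟨ cong ι (eval-* (varᴾ (g zero)) (prodᴾ (map varᴾ rest)) a) ⟩
    ι (eval (varᴾ (g zero)) a ℤ.* eval (prodᴾ (map varᴾ rest)) a)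
      ≡⟨ ι-* (eval (varᴾ (g zero)) a) (eval (prodᴾ (map varᴾ rest)) a) ⟩
    ι (eval (varᴾ (g zero)) a) * ι (eval (prodᴾ (map varᴾ rest)) a)
      ≡⟨ cong₂ _*_ (cong ι (eval-var (g zero) a))
           (along S (g ∘ suc) (to ∘ there) (drop-there ∘ from)) ⟩
    weight (inside ∷ S) (valueAt a ∘ g) ∎
    where rest = filter (_∈ₛ? T) (tabulate (g ∘ suc))
  along (outside ∷ S) g to from = trans
    (cong (λ es → ι (eval (prodᴾ (map varᴾ es)) a)) (filter-reject (_∈ₛ? T) λ e∈ → absurd (from e∈)))
    (along S (g ∘ suc) (to ∘ there) (drop-there ∘ from))
    where
    absurd : ¬ (zero ∈ₛ (outside ∷ S))
    absurd ()

eval-generating : ∀ {m} {P : Pred (Subset m) 0ℓ} (P? : Decidable P) Ts a →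
                  ι (eval (sumᴾ (map x^_ (filter P? Ts))) a) ≡ ∑ Ts λ T → χ (P? T) * weight T (valueAt a)
eval-generating P? []       a = ι-0
eval-generating P? (T ∷ Ts) a with P? T | eval-generating P? Ts a
... | yes _ | ih = trans (cong ι (eval-+ (x^ T) rest a)) (trans (ι-+ (eval (x^ T) a) (eval rest a))
                     (cong₂ _+_ (trans (eval-monomial T a) (sym (*-identityˡ _))) ih))
  where rest = sumᴾ (map x^_ (filter P? Ts))
... | no _  | ih = trans ih (trans (sym (+-identityˡ _)) (cong (_+ ∑ Ts (λ T → χ (P? T) * weight T (valueAt a))) (sym (zeroˡ _))))

-- Directed spanning trees

module _ {n : ℕ} (r : Fin n) where

  others : List (Fin n)
  others = filter (λ v → ¬? (v Finₚ.≟ r)) (allFin n)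

  others-unique : Unique (r ∷ others)
  others-unique =
    All.tabulate (λ v∈ → ≢-sym (proj₂ (∈-filter⁻ (λ v → ¬? (v Finₚ.≟ r)) {xs = allFin n} v∈))) ∷
    Uniqueₚ.filter⁺ (λ v → ¬? (v Finₚ.≟ r)) (Uniqueₚ.allFin⁺ n)

  others-complete : ∀ {v} → v ≢ r → v ∈ others
  others-complete v≢r = ∈-filter⁺ (λ v → ¬? (v Finₚ.≟ r)) (∈-allFin _) v≢r

  directedTrees : (G : Digraph n) → let open Digraph G in ∀ (a : Fin edges → ℚ) →
    arb r others (weights ends a) ≡
    ∑ (allSubsets edges) λ T → χ (isDirectedSpanningTree? G r T) * weight T a
  directedTrees G a = trans
    (expansion others-unique others-complete edges ends a (λ _ → nothing) simple (λ _ ()) refl)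
    (∑-cong (allSubsets edges) λ {T} _ → cong (_* weight T a)
      (χ-cong (oriented? _ r) (isDirectedSpanningTree? G r T)
        (λ o → oriented⇒unique _ (oriented-map drop inj₂ o))
        (λ h → oriented-map inj₂ drop (unique⇒oriented (Arc G T) h))))
    where
    open Digraph G
    drop : ∀ {T u v} → stateArc (λ _ → nothing) ends T u v → Arc G T u v
    drop (inj₂ s) = s

-- Both orientations of every edge

allSubsets-complete : ∀ {k} (T : Subset k) → T ∈ allSubsets k
allSubsets-complete []            = here refl
allSubsets-complete (inside  ∷ T) = ∈-++⁺ˡ (∈-map⁺ (inside ∷_) (allSubsets-complete T))
allSubsets-complete (outside ∷ T) = ∈-++⁺ʳ _ (∈-map⁺ (outside ∷_) (allSubsets-complete T))

allSubsets-unique : ∀ k → Unique (allSubsets k)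
allSubsets-unique zero    = [] ∷ []
allSubsets-unique (suc k) = Uniqueₚ.++⁺
  (Uniqueₚ.map⁺ (λ { refl → refl }) (allSubsets-unique k))
  (Uniqueₚ.map⁺ (λ { refl → refl }) (allSubsets-unique k))
  disjoint
  where
  disjoint : ∀ {T} → T ∈ map (inside ∷_) (allSubsets k) × T ∈ map (outside ∷_) (allSubsets k) → ⊥
  disjoint (p , q) with ∈-map⁻ (inside ∷_) p | ∈-map⁻ (outside ∷_) q
  ... | _ , _ , refl | _ , _ , ()

∑-subset : ∀ {k} (F : Subset k → ℚ) T → (∀ S → S ≢ T → F S ≡ 0ℚ) → ∑ (allSubsets k) F ≡ F T
∑-subset {k} F T eq = ∑-single (allSubsets-unique k) (allSubsets-complete T) λ {S} _ → eq S

∑-subsets-++ : ∀ j {k} (F : Subset (j ℕ.+ k) → ℚ) →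
  ∑ (allSubsets (j ℕ.+ k)) F ≡ ∑ (allSubsets j) λ T₁ → ∑ (allSubsets k) λ T₂ → F (T₁ Vec.++ T₂)
∑-subsets-++ zero        F = sym (+-identityʳ _)
∑-subsets-++ (suc j) {k} F = begin
  ∑ (map (inside ∷_) Ts List.++ map (outside ∷_) Ts) F
    ≡⟨ trans (∑-++ (map (inside ∷_) Ts) _ F) (cong₂ _+_ (∑-map (inside ∷_) Ts F) (∑-map (outside ∷_) Ts F)) ⟩
  ∑ Ts (F ∘ (inside ∷_)) + ∑ Ts (F ∘ (outside ∷_))
    ≡⟨ cong₂ _+_ (∑-subsets-++ j (F ∘ (inside ∷_))) (∑-subsets-++ j (F ∘ (outside ∷_))) ⟩
  ∑ (allSubsets j) (inner ∘ (inside ∷_)) + ∑ (allSubsets j) (inner ∘ (outside ∷_))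
    ≡⟨ sym (trans (∑-++ (map (inside ∷_) (allSubsets j)) _ inner)
         (cong₂ _+_ (∑-map (inside ∷_) (allSubsets j) inner) (∑-map (outside ∷_) (allSubsets j) inner))) ⟩
  ∑ (allSubsets (suc j)) inner ∎
  where
  Ts = allSubsets (j ℕ.+ k)
  inner : Subset (suc j) → ℚ
  inner T₁ = ∑ (allSubsets k) λ T₂ → F (T₁ Vec.++ T₂)

weight-++ : ∀ {j k} (T₁ : Subset j) (T₂ : Subset k) a →
            weight (T₁ Vec.++ T₂) a ≡ weight T₁ (a ∘ (_↑ˡ k)) * weight T₂ (a ∘ (j ↑ʳ_))
weight-++ []             T₂ a = sym (*-identityˡ _)
weight-++ (inside  ∷ T₁) T₂ a = trans (cong (a zero *_) (weight-++ T₁ T₂ (a ∘ suc))) (sym (*-assoc _ _ _))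
weight-++ (outside ∷ T₁) T₂ a = weight-++ T₁ T₂ (a ∘ suc)

weight-∪ : ∀ {k} (T₁ T₂ : Subset k) a → (∀ {e} → e ∈ₛ T₁ → ¬ e ∈ₛ T₂) →
           weight (T₁ ∪ T₂) a ≡ weight T₁ a * weight T₂ a
weight-∪ []             []             a _ = sym (*-identityˡ _)
weight-∪ (inside  ∷ T₁) (inside  ∷ T₂) a d = ⊥-elim (d here here)
weight-∪ (inside  ∷ T₁) (outside ∷ T₂) a d = trans
  (cong (a zero *_) (weight-∪ T₁ T₂ (a ∘ suc) λ p q → d (there p) (there q))) (sym (*-assoc _ _ _))
weight-∪ (outside ∷ T₁) (inside  ∷ T₂) a d = trans
  (cong (a zero *_) (weight-∪ T₁ T₂ (a ∘ suc) λ p q → d (there p) (there q))) (exchange _ _ _)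
  where
  opaque
    unfolding _+_
    exchange : ∀ x y z → x * (y * z) ≡ y * (x * z)
    exchange = solve-∀ ring
weight-∪ (outside ∷ T₁) (outside ∷ T₂) a d =
  weight-∪ T₁ T₂ (a ∘ suc) λ p q → d (there p) (there q)

module Bidirect {n : ℕ} (G : Graph n) where

  open Graph G

  endsOf : Fin edges ⊎ Fin edges → Fin n × Fin n
  endsOf = Sum.[ ends , swap ∘ ends ]′

  -- Forgets the direction: both copies of an edge carry the variable of that edge.
  edgeOf : Fin (edges ℕ.+ edges) → Fin edges
  edgeOf = Sum.[ id , id ]′ ∘ splitAt edges

  bidirected : Digraph n
  bidirected = record
    { edges    = edges ℕ.+ edges
    ; ends     = endsOf ∘ splitAt edges
    ; loopless = λ e → loopless′ (splitAt edges e)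
    ; simple   = λ e e′ eq → trans (sym (Finₚ.join-splitAt edges edges e))
        (trans (cong (Fin.join edges edges) (simple′ (splitAt edges e) (splitAt edges e′) eq))
               (Finₚ.join-splitAt edges edges e′))
    }
    where
    loopless′ : ∀ e → proj₁ (endsOf e) ≢ proj₂ (endsOf e)
    loopless′ (inj₁ e) = loopless e
    loopless′ (inj₂ e) = ≢-sym (loopless e)
    simple′ : ∀ e e′ → endsOf e ≡ endsOf e′ → e ≡ e′
    simple′ (inj₁ e) (inj₁ e′) eq = cong inj₁ (simple e e′ (inj₁ eq))
    simple′ (inj₂ e) (inj₂ e′) eq = cong inj₂ (simple e e′ (inj₁ (cong swap eq)))
    simple′ (inj₁ e) (inj₂ e′) eq with refl ← simple e e′ (inj₂ eq) = ⊥-elim (loopless e (cong proj₁ eq))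
    simple′ (inj₂ e) (inj₁ e′) eq with refl ← simple e e′ (inj₂ (cong swap eq)) = ⊥-elim (loopless e (cong proj₂ eq))

  adj⇒arc : ∀ {u v} → Adj G ⊤ u v → Arc bidirected ⊤ u v
  adj⇒arc (e , _ , inj₁ eq) = e ↑ˡ edges , ∈⊤ ,
    trans (cong endsOf (Finₚ.splitAt-↑ˡ edges e edges)) eq
  adj⇒arc (e , _ , inj₂ eq) = edges ↑ʳ e , ∈⊤ ,
    trans (cong endsOf (Finₚ.splitAt-↑ʳ edges edges e)) (cong swap eq)

  module _ (r : Fin n) where

    open Orientations G r

    oarc? : ∀ T₁ T₂ → B.Decidable (OArc T₁ T₂)
    oarc? T₁ T₂ u v = Finₚ.any? λ e →
      (e ∈ₛ? T₁ ×-dec ×-≡-dec Finₚ._≟_ Finₚ._≟_ (ends e) (u , v)) ⊎-dec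
      (e ∈ₛ? T₂ ×-dec ×-≡-dec Finₚ._≟_ Finₚ._≟_ (ends e) (v , u))

    oarc⇒arc : ∀ {T₁ T₂ u v} → OArc T₁ T₂ u v → Arc bidirected (T₁ Vec.++ T₂) u v
    oarc⇒arc {T₁} {T₂} (e , inj₁ (e∈ , eq)) = e ↑ˡ edges ,
      lookup⇒[]= (e ↑ˡ edges) _ (trans (lookup-++ˡ T₁ T₂ e) ([]=⇒lookup e∈)) ,
      trans (cong endsOf (Finₚ.splitAt-↑ˡ edges e edges)) eq
    oarc⇒arc {T₁} {T₂} (e , inj₂ (e∈ , eq)) = edges ↑ʳ e ,
      lookup⇒[]= (edges ↑ʳ e) _ (trans (lookup-++ʳ T₁ T₂ e) ([]=⇒lookup e∈)) ,
      trans (cong endsOf (Finₚ.splitAt-↑ʳ edges edges e)) (cong swap eq)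

    arc⇒oarc : ∀ {T₁ T₂ u v} → Arc bidirected (T₁ Vec.++ T₂) u v → OArc T₁ T₂ u v
    arc⇒oarc {T₁} {T₂} (e , e∈ , eq) with splitAt edges e in split
    ... | inj₁ e′ with refl ← Finₚ.splitAt⁻¹-↑ˡ split = e′ ,
      inj₁ (lookup⇒[]= e′ T₁ (trans (sym (lookup-++ˡ T₁ T₂ e′)) ([]=⇒lookup e∈)) , eq)
    ... | inj₂ e′ with refl ← Finₚ.splitAt⁻¹-↑ʳ split = e′ ,
      inj₂ (lookup⇒[]= e′ T₂ (trans (sym (lookup-++ʳ T₁ T₂ e′)) ([]=⇒lookup e∈)) , cong swap eq)

    module _ (a : Fin edges → ℚ) where

      private
        Ts = allSubsets edges

        _≟ₛ_ : B.DecidableEquality (Subset edges)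
        _≟ₛ_ = Vec-≡-dec Boolₚ._≟_

        oriented : Subset edges → Subset edges → ℚ
        oriented T₁ T₂ = χ (oriented? (oarc? T₁ T₂) r) * (weight T₁ a * weight T₂ a)

        fibre : Subset edges → ℚ
        fibre T = ∑ Ts λ T₁ → ∑ Ts λ T₂ → χ (T ≟ₛ (T₁ ∪ T₂)) * oriented T₁ T₂

        off-fibre : ∀ T T₁ T₂ → ¬ (T ≡ T₁ ∪ T₂ × Oriented (OArc T₁ T₂) r) →
                    χ (T ≟ₛ (T₁ ∪ T₂)) * oriented T₁ T₂ ≡ 0ℚ
        off-fibre T T₁ T₂ h with T ≟ₛ (T₁ ∪ T₂)
        ... | no _   = zeroˡ _
        ... | yes eq = trans (*-identityˡ _)
          (trans (cong (_* (weight T₁ a * weight T₂ a)) (χ-no (oriented? (oarc? T₁ T₂) r) λ o → h (eq , o))) (zeroˡ _))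

        -- Every oriented pair has a spanning tree as its union, so other edge sets receive nothing.
        -- A tree receives the one pair of `forward` and `backward`, which are disjoint, so that
        -- their weights multiply to the weight of `T`.
        fibre-value : ∀ T → fibre T ≡ χ (isSpanningTree? G T) * weight T a
        fibre-value T = by-cases (isSpanningTree? G T)
          where
          by-cases : (d : Dec (IsSpanningTree G T)) → fibre T ≡ χ d * weight T a
          by-cases (no ¬tree) = trans
            (∑-zero Ts λ {T₁} _ → ∑-zero Ts λ {T₂} _ → off-fibre T T₁ T₂
              λ { (refl , o) → ¬tree (oriented⇒spanningTree o) })
            (sym (zeroˡ _))
          by-cases (yes tree) = begin
            fibre T
              ≡⟨ ∑-subset _ forward (λ T₁ T₁≢ → ∑-zero Ts λ {T₂} _ → off-fibre T T₁ T₂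
                   λ (eq , o) → T₁≢ (proj₁ (orientation-unique (sym eq) o))) ⟩
            ∑ Ts (λ T₂ → χ (T ≟ₛ (forward ∪ T₂)) * oriented forward T₂)
              ≡⟨ ∑-subset _ backward (λ T₂ T₂≢ → off-fibre T forward T₂
                   λ (eq , o) → T₂≢ (proj₂ (orientation-unique (sym eq) o))) ⟩
            χ (T ≟ₛ (forward ∪ backward)) * oriented forward backward
              ≡⟨ cong₂ _*_ (χ-yes (T ≟ₛ (forward ∪ backward)) (sym forward∪backward))
                   (trans (cong (_* (weight forward a * weight backward a))
                      (χ-yes (oriented? (oarc? forward backward) r) orientation)) (*-identityˡ _)) ⟩
            1ℚ * (weight forward a * weight backward a)
              ≡⟨ cong (1ℚ *_) (trans
                   (sym (weight-∪ forward backward a (oriented⇒disjoint orientation)))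
                   (cong (λ T → weight T a) forward∪backward)) ⟩
            1ℚ * weight T a ∎
            where open SpanningTree tree

      bidirectedTrees : arb r (others r) (weights (Digraph.ends bidirected) (a ∘ edgeOf)) ≡
                        ∑ Ts λ T → χ (isSpanningTree? G T) * weight T a
      bidirectedTrees = begin
        arb r (others r) (weights (Digraph.ends bidirected) (a ∘ edgeOf))
          ≡⟨ directedTrees r bidirected (a ∘ edgeOf) ⟩
        ∑ (allSubsets (edges ℕ.+ edges)) (λ T → χ (isDirectedSpanningTree? bidirected r T) * weight T (a ∘ edgeOf))
          ≡⟨ ∑-subsets-++ edges _ ⟩
        ∑ Ts (λ T₁ → ∑ Ts λ T₂ → χ (isDirectedSpanningTree? bidirected r (T₁ Vec.++ T₂)) * weight (T₁ Vec.++ T₂) (a ∘ edgeOf))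
          ≡⟨ ∑-cong Ts (λ {T₁} _ → ∑-cong Ts λ {T₂} _ → cong₂ _*_ (tree-χ T₁ T₂)
               (trans (weight-++ T₁ T₂ (a ∘ edgeOf)) (cong₂ _*_
                 (weight-cong T₁ λ e → cong (a ∘ Sum.[ id , id ]′) (Finₚ.splitAt-↑ˡ edges e edges))
                 (weight-cong T₂ λ e → cong (a ∘ Sum.[ id , id ]′) (Finₚ.splitAt-↑ʳ edges edges e))))) ⟩
        ∑ Ts (λ T₁ → ∑ Ts (oriented T₁))
          -- Inserts the sum over `T` of the indicator of `T ≡ T₁ ∪ T₂`, which equals 1, so that the
          -- sums can be exchanged.
          ≡⟨ ∑-cong Ts (λ {T₁} _ → ∑-cong Ts λ {T₂} _ → sym (trans
               (∑-subset _ (T₁ ∪ T₂) λ T T≢ → trans (cong (_* oriented T₁ T₂) (χ-no (T ≟ₛ (T₁ ∪ T₂)) T≢)) (zeroˡ _))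
               (trans (cong (_* oriented T₁ T₂) (χ-yes ((T₁ ∪ T₂) ≟ₛ (T₁ ∪ T₂)) refl)) (*-identityˡ _)))) ⟩
        ∑ Ts (λ T₁ → ∑ Ts λ T₂ → ∑ Ts λ T → χ (T ≟ₛ (T₁ ∪ T₂)) * oriented T₁ T₂)
          ≡⟨ trans (∑-cong Ts λ {T₁} _ → ∑-swap Ts Ts _) (∑-swap Ts Ts _) ⟩
        ∑ Ts fibre
          ≡⟨ ∑-cong Ts (λ {T} _ → fibre-value T) ⟩
        ∑ Ts (λ T → χ (isSpanningTree? G T) * weight T a) ∎
        where
        tree-χ : ∀ T₁ T₂ → χ (isDirectedSpanningTree? bidirected r (T₁ Vec.++ T₂)) ≡ χ (oriented? (oarc? T₁ T₂) r)
        tree-χ T₁ T₂ = χ-cong (isDirectedSpanningTree? bidirected r (T₁ Vec.++ T₂)) (oriented? (oarc? T₁ T₂) r)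
          (λ h → oriented-map arc⇒oarc oarc⇒arc (unique⇒oriented _ h))
          (λ o → oriented⇒unique _ (oriented-map oarc⇒arc arc⇒oarc o))

-- Polynomials with positive coefficients

-- Positivity is asked of the listed terms and not of the collected coefficients, so closure under
-- sums and products is visible on the lists. Nonemptiness keeps the polynomial nonzero.
data PositivePoly {m : ℕ} : Poly m → Set where
  single : ∀ k μ → PositivePoly ((ℤ.+ suc k , μ) ∷ [])
  cons   : ∀ k μ {p} → PositivePoly p → PositivePoly ((ℤ.+ suc k , μ) ∷ p)

evalᴹ-suc : ∀ {m} (μ : Monomial m) a → ∃ λ j → evalᴹ μ a ≡ suc j
evalᴹ-suc []      []      = 0 , refl
evalᴹ-suc (k ∷ μ) (x ∷ a) = product (power k) (evalᴹ-suc μ a)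
  where
  product : ∀ {i j} → (∃ λ i′ → i ≡ suc i′) → (∃ λ j′ → j ≡ suc j′) → ∃ λ k → i ℕ.* j ≡ suc k
  product (_ , refl) (_ , refl) = _ , refl
  power : ∀ k → ∃ λ j → suc x ^ k ≡ suc j
  power zero    = 0 , refl
  power (suc k) = product (x , refl) (power k)

module _ {m : ℕ} where

  positive-++ : {p q : Poly m} → PositivePoly p → PositivePoly q → PositivePoly (p ++ q)
  positive-++ (single k μ) q⁺ = cons k μ q⁺
  positive-++ (cons k μ p⁺) q⁺ = cons k μ (positive-++ p⁺ q⁺)

  positive-* : {p q : Poly m} → PositivePoly p → PositivePoly q → PositivePoly (p *ᴾ q)
  positive-* p⁺ q⁺ = go p⁺
    where
    times : ∀ k μ {q : Poly m} → PositivePoly q →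
            PositivePoly (map (λ (d , ν) → ℤ.+ suc k ℤ.* d , Vec.zipWith ℕ._+_ μ ν) q)
    times k μ (single l ν) = single _ _
    times k μ (cons l ν q⁺) = cons _ _ (times k μ q⁺)
    go : ∀ {p} → PositivePoly p → PositivePoly (p *ᴾ _)
    go (single k μ) = subst PositivePoly (sym (++-identityʳ _)) (times k μ q⁺)
    go (cons k μ p⁺) = positive-++ (times k μ q⁺) (go p⁺)

  positive-nonzero : {p : Poly m} → PositivePoly p → ¬ p ≈ᴾ 0ᴾ
  positive-nonzero (single k μ) eq with eq μ
  ... | eq′ rewrite dec-true (Vec-≡-dec ℕₚ._≟_ μ μ) refl with () ← eq′
  positive-nonzero (cons k μ p⁺) eq with eq μ | nonnegative p⁺ μ
    where
    nonnegative : ∀ {p : Poly m} → PositivePoly p → ∀ μ → ∃ λ j → coeff p μ ≡ ℤ.+ j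
    nonnegative (single k ν) μ with does (Vec-≡-dec ℕₚ._≟_ ν μ)
    ... | true  = _ , refl
    ... | false = _ , refl
    nonnegative (cons k ν p⁺) μ with nonnegative p⁺ μ | does (Vec-≡-dec ℕₚ._≟_ ν μ)
    ... | j , eq | true  = _ , cong (λ e → ℤ.+ suc k ℤ.+ e) eq
    ... | j , eq | false = j , trans (ℤₚ.+-identityˡ _) eq
  ... | eq′ | j , eq″ rewrite dec-true (Vec-≡-dec ℕₚ._≟_ μ μ) refl | eq″ with () ← eq′

  positive-eval : {p : Poly m} → PositivePoly p → ∀ a → ∃ λ j → eval p a ≡ ℤ.+ suc j
  positive-eval (single k μ) a with evalᴹ-suc μ a
  ... | j , eq = _ , cong (λ e → ℤ.+ suc k ℤ.* ℤ.+ e ℤ.+ ℤ.0ℤ) eq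
  positive-eval (cons k μ p⁺) a with evalᴹ-suc μ a | positive-eval p⁺ a
  ... | j , eq | l , eq′ = _ , cong₂ (λ e f → ℤ.+ suc k ℤ.* ℤ.+ e ℤ.+ f) eq eq′

  PositiveFrac : Frac m → Set
  PositiveFrac f = PositivePoly (num f) × PositivePoly (den f)

-- Subtraction-free programs

opaque
  unfolding _+_

  -- Totalised by the value 0 at 0, so that formulas with quotients need no proof arguments;
  -- `Has-nonzero` supplies the side condition for `*-inv`.
  inv : ℚ → ℚ
  inv x with x ℚₚ.≟ 0ℚ
  ... | yes _  = 0ℚ
  ... | no x≢0 = ℚ.1/_ x {{ℚ.≢-nonZero x≢0}}

  *-inv : ∀ {x} → x ≢ 0ℚ → x * inv x ≡ 1ℚ
  *-inv {x} x≢0 with x ℚₚ.≟ 0ℚ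
  ... | yes x≡0 = ⊥-elim (x≢0 x≡0)
  ... | no x≢0′ = ℚₚ.*-inverseʳ x {{ℚ.≢-nonZero x≢0′}}

record Program (m : ℕ) : Set where
  field
    {count}  : ℕ
    code     : Gates m count
    noSub    : NoSub code
    positive : VecAll.All PositiveFrac (gateValues code)

open Program

module _ {m : ℕ} where

  valueOf : (P : Program m) → Wire m (count P) → Frac m
  valueOf P = wireValue (gateValues (code P))

  wire-positive : ∀ P w → PositiveFrac (valueOf P w)
  wire-positive P (var i)          = single _ _ , single _ _
  wire-positive P (scalar (suc c)) = single _ _ , single _ _
  wire-positive P (gate g)         = VecAllₚ.lookup⁺ (positive P) g

  -- Cross-multiplied and tested only at positive integer points. As positive denominators do not
  -- vanish there, `v` determines the rational function, and gates can be reasoned about through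
  -- their rational values.
  Represents : Frac m → (Point m → ℚ) → Set
  Represents f v = ∀ a → ι (eval (num f) a) ≡ v a * ι (eval (den f) a)

  record Has (P : Program m) (v : Point m → ℚ) : Set where
    constructor _,_
    field
      wire       : Wire m (count P)
      represents : Represents (valueOf P wire) v

  Has-cong : ∀ {P u v} → (∀ a → u a ≡ v a) → Has P u → Has P v
  Has-cong eq (w , rep) = w , λ a → trans (rep a) (cong (_* _) (eq a))

  -- Numerators with positive coefficients have positive values. Hence every available value may be
  -- used as a divisor.
  Has-nonzero : ∀ {P v} → Has P v → ∀ a → v a ≢ 0ℚ
  Has-nonzero {P} (w , rep) a v≡0 with positive-eval (proj₁ (wire-positive P w)) a
  ... | j , eq with () ← trans (sym eq) (ι-injective
    (trans (rep a) (trans (cong (_* _) v≡0) (trans (zeroˡ _) (sym ι-0)))))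

  _≼_ : Program m → Program m → Set
  P ≼ Q = ∀ {v} → Has P v → Has Q v

  -- A cost-graded monad of program extensions: `bind` adds the bounds, so the type of a
  -- construction records how many gates it may use.
  record Build (c : ℕ) (P : Program m) (X : Program m → Set) : Set where
    constructor built
    field
      program : Program m
      bound   : count program ≤ c ℕ.+ count P
      embeds  : P ≼ program
      result  : X program

  return : ∀ {P X} → X P → Build 0 P X
  return x = built _ ℕₚ.≤-refl id x

  bind : ∀ {c d P X Y} → Build c P X → (∀ {Q} → P ≼ Q → X Q → Build d Q Y) → Build (c ℕ.+ d) P Y
  bind {c} {d} {P} (built Q c≥ P≼Q x) f =
    let built R d≥ Q≼R y = f P≼Q x in
    built R (ℕₚ.≤-trans d≥ (ℕₚ.≤-trans (ℕₚ.+-monoʳ-≤ d c≥) (ℕₚ.≤-reflexive (arrange c d (count P)))))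
      (Q≼R ∘ P≼Q) y
    where
    arrange : ∀ c d p → d ℕ.+ (c ℕ.+ p) ≡ c ℕ.+ d ℕ.+ p
    arrange = ℕ-RingSolver.solve-∀

  relax : ∀ {c d P X} → c ≤ d → Build c P X → Build d P X
  relax {P = P} c≤d (built Q c≥ P≼Q x) = built Q (ℕₚ.≤-trans c≥ (ℕₚ.+-monoˡ-≤ (count P) c≤d)) P≼Q x

  private
    weaken : ∀ {k} → Wire m k → Wire m (suc k)
    weaken (var i)    = var i
    weaken (scalar c) = scalar c
    weaken (gate g)   = gate (suc g)

    weaken-value : ∀ {k} (vs : Vec (Frac m) k) f w → wireValue (f ∷ vs) (weaken w) ≡ wireValue vs w
    weaken-value vs f (var i)    = refl
    weaken-value vs f (scalar c) = refl
    weaken-value vs f (gate g)   = refl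

    emit : ∀ {P} op w₁ w₂ {v} → op ≢ sub →
           PositiveFrac (⟦ op ⟧ (valueOf P w₁) (valueOf P w₂)) →
           Represents (⟦ op ⟧ (valueOf P w₁) (valueOf P w₂)) v → Build 1 P (λ Q → Has Q v)
    emit {P} op w₁ w₂ op≢sub f⁺ rep =
      built record { code = code P ▷ mkGate op w₁ w₂ ; noSub = noSub P ▷ op≢sub ; positive = f⁺ VecAll.∷ positive P }
        ℕₚ.≤-refl
        (λ {v} (w , r) → weaken w , subst (λ f → Represents f v) (sym (weaken-value (gateValues (code P)) _ w)) r)
        (gate zero , rep)

    eval₂ : ∀ (p q : Poly m) a → ι (eval (p *ᴾ q) a) ≡ ι (eval p a) * ι (eval q a)
    eval₂ p q a = trans (cong ι (eval-* p q a)) (ι-* (eval p a) (eval q a))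

  has-+ : ∀ {P u v} → Has P u → Has P v → Build 1 P (λ Q → Has Q λ a → u a + v a)
  has-+ {P} {u} {v} (w₁ , r₁) (w₂ , r₂) = emit add w₁ w₂ (λ ())
    (positive-++ (positive-* n₁⁺ d₂⁺) (positive-* n₂⁺ d₁⁺) , positive-* d₁⁺ d₂⁺)
    λ a → begin
      ι (eval (n₁ *ᴾ d₂ +ᴾ n₂ *ᴾ d₁) a)
        ≡⟨ trans (cong ι (eval-+ (n₁ *ᴾ d₂) (n₂ *ᴾ d₁) a)) (ι-+ (eval (n₁ *ᴾ d₂) a) (eval (n₂ *ᴾ d₁) a)) ⟩
      ι (eval (n₁ *ᴾ d₂) a) + ι (eval (n₂ *ᴾ d₁) a)
        ≡⟨ cong₂ _+_ (eval₂ n₁ d₂ a) (eval₂ n₂ d₁ a) ⟩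
      ι (eval n₁ a) * ι (eval d₂ a) + ι (eval n₂ a) * ι (eval d₁ a)
        ≡⟨ cong₂ (λ x y → x * ι (eval d₂ a) + y * ι (eval d₁ a)) (r₁ a) (r₂ a) ⟩
      u a * ι (eval d₁ a) * ι (eval d₂ a) + v a * ι (eval d₂ a) * ι (eval d₁ a)
        ≡⟨ factor (u a) (v a) (ι (eval d₁ a)) (ι (eval d₂ a)) ⟩
      (u a + v a) * (ι (eval d₁ a) * ι (eval d₂ a))
        ≡⟨ cong ((u a + v a) *_) (sym (eval₂ d₁ d₂ a)) ⟩
      (u a + v a) * ι (eval (d₁ *ᴾ d₂) a) ∎
    where
    n₁ = num (valueOf P w₁); n₂ = num (valueOf P w₂)
    d₁ = den (valueOf P w₁); d₂ = den (valueOf P w₂)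
    n₁⁺ = proj₁ (wire-positive P w₁); n₂⁺ = proj₁ (wire-positive P w₂)
    d₁⁺ = proj₂ (wire-positive P w₁); d₂⁺ = proj₂ (wire-positive P w₂)
    opaque
      unfolding _+_
      factor : ∀ u v c d → u * c * d + v * d * c ≡ (u + v) * (c * d)
      factor = solve-∀ ring

  has-* : ∀ {P u v} → Has P u → Has P v → Build 1 P (λ Q → Has Q λ a → u a * v a)
  has-* {P} {u} {v} (w₁ , r₁) (w₂ , r₂) = emit mul w₁ w₂ (λ ())
    (positive-* n₁⁺ n₂⁺ , positive-* d₁⁺ d₂⁺)
    λ a → begin
      ι (eval (n₁ *ᴾ n₂) a)
        ≡⟨ trans (eval₂ n₁ n₂ a) (cong₂ _*_ (r₁ a) (r₂ a)) ⟩
      u a * ι (eval d₁ a) * (v a * ι (eval d₂ a))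
        ≡⟨ factor (u a) (v a) (ι (eval d₁ a)) (ι (eval d₂ a)) ⟩
      u a * v a * (ι (eval d₁ a) * ι (eval d₂ a))
        ≡⟨ cong (u a * v a *_) (sym (eval₂ d₁ d₂ a)) ⟩
      u a * v a * ι (eval (d₁ *ᴾ d₂) a) ∎
    where
    n₁ = num (valueOf P w₁); n₂ = num (valueOf P w₂)
    d₁ = den (valueOf P w₁); d₂ = den (valueOf P w₂)
    n₁⁺ = proj₁ (wire-positive P w₁); n₂⁺ = proj₁ (wire-positive P w₂)
    d₁⁺ = proj₂ (wire-positive P w₁); d₂⁺ = proj₂ (wire-positive P w₂)
    opaque
      unfolding _+_
      factor : ∀ u v c d → u * c * (v * d) ≡ u * v * (c * d)
      factor = solve-∀ ring

  has-÷ : ∀ {P u v} → Has P u → Has P v → Build 1 P (λ Q → Has Q λ a → u a * inv (v a))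
  has-÷ {P} {u} {v} (w₁ , r₁) h@(w₂ , r₂) = emit div w₁ w₂ (λ ())
    (positive-* n₁⁺ d₂⁺ , positive-* d₁⁺ n₂⁺)
    λ a → begin
      ι (eval (n₁ *ᴾ d₂) a)
        ≡⟨ trans (eval₂ n₁ d₂ a) (cong (_* ι (eval d₂ a)) (r₁ a)) ⟩
      u a * ι (eval d₁ a) * ι (eval d₂ a)
        ≡⟨ sym (*-identityˡ _) ⟩
      1ℚ * (u a * ι (eval d₁ a) * ι (eval d₂ a))
        ≡⟨ cong (_* (u a * ι (eval d₁ a) * ι (eval d₂ a))) (sym (*-inv (Has-nonzero h a))) ⟩
      v a * inv (v a) * (u a * ι (eval d₁ a) * ι (eval d₂ a))
        ≡⟨ arrange (u a) (v a) (inv (v a)) (ι (eval d₁ a)) (ι (eval d₂ a)) ⟩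
      u a * inv (v a) * (ι (eval d₁ a) * (v a * ι (eval d₂ a)))
        ≡⟨ cong (λ x → u a * inv (v a) * (ι (eval d₁ a) * x)) (sym (r₂ a)) ⟩
      u a * inv (v a) * (ι (eval d₁ a) * ι (eval n₂ a))
        ≡⟨ cong (u a * inv (v a) *_) (sym (eval₂ d₁ n₂ a)) ⟩
      u a * inv (v a) * ι (eval (d₁ *ᴾ n₂) a) ∎
    where
    n₁ = num (valueOf P w₁); n₂ = num (valueOf P w₂)
    d₁ = den (valueOf P w₁); d₂ = den (valueOf P w₂)
    n₁⁺ = proj₁ (wire-positive P w₁); n₂⁺ = proj₁ (wire-positive P w₂)
    d₁⁺ = proj₂ (wire-positive P w₁); d₂⁺ = proj₂ (wire-positive P w₂)
    opaque
      unfolding _+_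
      arrange : ∀ u v i c d → v * i * (u * c * d) ≡ u * i * (c * (v * d))
      arrange = solve-∀ ring

  -- Subtraction-free circuits cannot compute 0, so zero entries are tracked separately.
  Entry : Program m → Bool → (Point m → ℚ) → Set
  Entry P true  v = Has P v
  Entry P false v = ∀ a → v a ≡ 0ℚ

  Entry-cong : ∀ {P} b {u v} → (∀ a → u a ≡ v a) → Entry P b u → Entry P b v
  Entry-cong true  eq h = Has-cong eq h
  Entry-cong false eq z = λ a → trans (sym (eq a)) (z a)

  Entry-≼ : ∀ {P Q} b {v} → P ≼ Q → Entry P b v → Entry Q b v
  Entry-≼ true  P≼Q h = P≼Q h
  Entry-≼ false P≼Q z = z

  entry-+ : ∀ {P} b c {u v} → Entry P b u → Entry P c v → Build 1 P (λ Q → Entry Q (b ∨ c) λ a → u a + v a)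
  entry-+ true  true  h h′ = has-+ h h′
  entry-+ true  false h z  = relax z≤n (return (Has-cong (λ a → trans (sym (+-identityʳ _)) (cong (_ +_) (sym (z a)))) h))
  entry-+ false c     z e  = relax z≤n (return (Entry-cong c (λ a → trans (sym (+-identityˡ _)) (cong (_+ _) (sym (z a)))) e))

  entry-* : ∀ {P} b c {u v} → Entry P b u → Entry P c v → Build 1 P (λ Q → Entry Q (b ∧ c) λ a → u a * v a)
  entry-* true  true  h h′ = has-* h h′
  entry-* true  false h z  = relax z≤n (return λ a → trans (cong (_ *_) (z a)) (zeroʳ _))
  entry-* false c     z e  = relax z≤n (return λ a → trans (cong (_* _) (z a)) (zeroˡ _))

  entry-÷ : ∀ {P} b {u v} → Entry P b u → Has P v → Build 1 P (λ Q → Entry Q b λ a → u a * inv (v a))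
  entry-÷ true  h h′ = has-÷ h h′
  entry-÷ false z h′ = relax z≤n (return λ a → trans (cong (_* _) (z a)) (zeroˡ _))

  module _ {A : Set} where

    build-all : ∀ {c P} {Y : Program m → A → Set} (xs : List A) →
                (∀ {Q R x} → Q ≼ R → Y Q x → Y R x) →
                (∀ {x Q} → x ∈ xs → P ≼ Q → Build c Q (λ R → Y R x)) →
                Build (length xs ℕ.* c) P (λ Q → ∀ {x} → x ∈ xs → Y Q x)
    build-all []       mono f = return λ ()
    build-all (x ∷ xs) mono f = bind (f (here refl) id) λ P≼Q y →
      let built R c≥ Q≼R ys = build-all xs mono (λ x∈ Q≼R → f (there x∈) (Q≼R ∘ P≼Q))
      in built R c≥ Q≼R λ { (here refl) → mono Q≼R y ; (there x∈) → ys x∈ }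

    entry-∑ : ∀ {P} xs (b : A → Bool) (v : A → Point m → ℚ) → (∀ {x} → x ∈ xs → Entry P (b x) (v x)) →
              Build (length xs) P (λ Q → Entry Q (any b xs) λ a → ∑ xs λ x → v x a)
    entry-∑ []       b v e = return λ a → refl
    entry-∑ (x ∷ xs) b v e = relax (ℕₚ.≤-reflexive (ℕₚ.+-comm (length xs) 1))
      (bind (entry-∑ xs b v (e ∘ there)) λ P≼Q es →
        entry-+ (b x) (any b xs) (Entry-≼ (b x) P≼Q (e (here refl))) es)

-- Vertex elimination

module _ {n : ℕ} (r : Fin n) where

  -- The invariant that keeps the pivots nonzero: a walk to `r` along entries known to be nonzero,
  -- through vertices not yet eliminated.
  data Linked (b : Fin n → Fin n → Bool) (vs : List (Fin n)) : Fin n → Set where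
    stop : Linked b vs r
    step : ∀ {i j} → j ∈ r ∷ vs → b i j ≡ true → Linked b vs j → Linked b vs i

  -- The zero pattern after eliminating `v`, with fill-in wherever a path through `v` exists. It is
  -- exact, because positive values cannot cancel.
  support : (Fin n → Fin n → Bool) → Fin n → Fin n → Fin n → Bool
  support b v i j = b i j ∨ (b i v ∧ b v j)

  any-true : ∀ {A : Set} (b : A → Bool) {xs x} → x ∈ xs → b x ≡ true → any b xs ≡ true
  any-true b {xs = _ ∷ xs} (here refl) eq = cong (_∨ any b xs) eq
  any-true b {xs = y ∷ _}  (there x∈)  eq = trans (cong (b y ∨_) (any-true b x∈ eq)) (Boolₚ.∨-zeroʳ (b y))

  module _ {b : Fin n → Fin n → Bool} {v : Fin n} {vs : List (Fin n)} (v≢r : v ≢ r) where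

    -- A passage through `v` becomes a fill-in entry; loops at `v`, which diagonal entries may
    -- create, are skipped.
    linked-eliminate : ∀ {i} → i ≢ v → Linked b (v ∷ vs) i → Linked (support b v) vs i
    linked-through   : ∀ {i} → b i v ≡ true → Linked b (v ∷ vs) v → Linked (support b v) vs i

    linked-eliminate i≢v stop = stop
    linked-eliminate {i} i≢v (step {j = j} j∈ bij l) with j Finₚ.≟ v
    ... | yes refl = linked-through bij l
    ... | no j≢v   = step (remain r j≢v j∈) (cong (_∨ (b i v ∧ b v j)) bij) (linked-eliminate j≢v l)

    linked-through biv stop = ⊥-elim (v≢r refl)
    linked-through {i} biv (step {j = j} j∈ bvj l) with j Finₚ.≟ v
    ... | yes refl = linked-through biv l
    ... | no j≢v   = step (remain r j≢v j∈)
      (trans (cong (b i j ∨_) (cong₂ _∧_ biv bvj)) (Boolₚ.∨-zeroʳ (b i j))) (linked-eliminate j≢v l)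

    -- The first step that really leaves `v` exhibits a nonzero summand of the pivot.
    linked-row : Linked b (v ∷ vs) v → any (b v) (r ∷ vs) ≡ true
    linked-row stop = ⊥-elim (v≢r refl)
    linked-row (step {j = j} j∈ bvj l) with j Finₚ.≟ v
    ... | yes refl = linked-row l
    ... | no j≢v   = any-true (b v) (remain r j≢v j∈) bvj

-- With `l` non-root vertices left after `v`: `suc l` gates for the pivot; for each of `l` rows, one
-- division and two gates for each of `suc l` columns; at the end one multiplication by the pivot.
cost : ℕ → ℕ
cost zero    = 0
cost (suc l) = suc l ℕ.+ (l ℕ.* (1 ℕ.+ suc l ℕ.* 2) ℕ.+ (cost l ℕ.+ 1))

module _ {n m : ℕ} {r : Fin n} where

  eliminate-all : ∀ vs → Unique (r ∷ vs) → ∀ {P : Program m} (W : Fin n → Fin n → Point m → ℚ) b →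
    (∀ {i j} → i ∈ vs → j ∈ r ∷ vs → Entry P (b i j) (W i j)) →
    (∀ {i} → i ∈ vs → Linked r b vs i) →
    Build (cost (length vs)) P (λ Q → Has Q λ a → arb r vs (λ i j → W i j a))
  eliminate-all [] _ W b e linked = return (scalar 1 , λ a → sym (*-identityˡ _))
  eliminate-all (v ∷ vs) un′@((r≢v ∷ r∉) ∷ v∉ ∷ un) {P} W b e linked =
    bind (entry-∑ (r ∷ vs) (b v) (W v) (e (here refl) ∘ weaken)) λ {Q} P≼Q s →
    -- Reachability of the root turns the Boolean of the pivot into `true`, which makes the pivot an
    -- available divisor.
    let hs = subst (λ c → Entry Q c (λ a → ∑ (r ∷ vs) λ j → W v j a)) (linked-row r (≢-sym r≢v) (linked (here refl))) s in
    bind (build-all vs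
      (λ Q≼R row {j} j∈ → Entry-≼ (b′ _ j) Q≼R (row j∈))
      -- The quotient by the pivot is computed once and shared by the whole row, which leaves one
      -- multiplication and one addition per entry.
      (λ {i} i∈ Q≼R → bind (entry-÷ (b i v) (Entry-≼ (b i v) (Q≼R ∘ P≼Q) (e (there i∈) (there (here refl)))) (Q≼R hs)) λ R≼S q →
        build-all {Y = λ R j → Entry R (b′ i j) (W′ i j)} (r ∷ vs)
          (λ {_} {_} {j} → Entry-≼ (b′ i j))
          (λ {j} j∈ S≼T → bind
            (entry-* (b i v) (b v j) (Entry-≼ (b i v) S≼T q)
              (Entry-≼ (b v j) (S≼T ∘ R≼S ∘ Q≼R ∘ P≼Q) (e (here refl) (weaken j∈)))) λ T≼U p →
            entry-+ (b i j) (b i v ∧ b v j)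
              (Entry-≼ (b i j) (T≼U ∘ S≼T ∘ R≼S ∘ Q≼R ∘ P≼Q) (e (there i∈) (weaken j∈))) p))) λ Q≼R e′ →
    bind (eliminate-all vs (r∉ ∷ un) W′ b′ (λ i∈ j∈ → e′ i∈ j∈)
           (λ i∈ → linked-eliminate r (≢-sym r≢v) (≢-sym (All.lookup v∉ i∈)) (linked (there i∈)))) λ R≼S rest →
    rename (eliminated (Has-nonzero hs)) (has-* (R≼S (Q≼R hs)) rest)
    where
    weaken : ∀ {j} → j ∈ r ∷ vs → j ∈ r ∷ v ∷ vs
    weaken (here eq)  = here eq
    weaken (there j∈) = there (there j∈)
    b′ = support r b v
    W′ : Fin n → Fin n → Point m → ℚ
    W′ i j a = W i j a + W i v a * inv (∑ (r ∷ vs) λ k → W v k a) * W v j a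
    rename : ∀ {c} {P : Program m} {u w} → (∀ a → u a ≡ w a) → Build c P (λ Q → Has Q u) → Build c P (λ Q → Has Q w)
    rename eq (built Q c≥ P≼Q h) = built Q c≥ P≼Q (Has-cong eq h)
    eliminated : (∀ a → ∑ (r ∷ vs) (λ k → W v k a) ≢ 0ℚ) → ∀ a →
      ∑ (r ∷ vs) (λ k → W v k a) * arb r vs (λ i j → W′ i j a) ≡ arb r (v ∷ vs) (λ i j → W i j a)
    eliminated nonzero a = sym (eliminate r un′ (λ i j → W i j a) _ (*-inv (nonzero a)))

-- Here `suc l` counts the root as well. The cost grows like two thirds of the cube; the factor 2 is
-- generous and lets the induction step hold with the explicit slack in `difference`.
cost-bound : ∀ l → cost l ≤ 2 ℕ.* suc l ^ 3
cost-bound zero    = z≤n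
cost-bound (suc l) = ℕₚ.≤-trans
  (ℕₚ.+-monoʳ-≤ (suc l) (ℕₚ.+-monoʳ-≤ (l ℕ.* (1 ℕ.+ suc l ℕ.* 2)) (ℕₚ.+-monoˡ-≤ 1 (cost-bound l))))
  (ℕₚ.≤-trans (ℕₚ.m≤m+n _ _) (ℕₚ.≤-reflexive (difference l)))
  where
  difference : ∀ l → suc l ℕ.+ (l ℕ.* (1 ℕ.+ suc l ℕ.* 2) ℕ.+ (2 ℕ.* (suc l ℕ.* (suc l ℕ.* (suc l ℕ.* 1))) ℕ.+ 1))
                     ℕ.+ (12 ℕ.+ 14 ℕ.* l ℕ.+ 4 ℕ.* (l ℕ.* l))
                     ≡ 2 ℕ.* (suc (suc l) ℕ.* (suc (suc l) ℕ.* (suc (suc l) ℕ.* 1)))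
  difference = ℕ-RingSolver.solve-∀

-- The circuits

module _ {n : ℕ} where

  weights-none : ∀ {k} (ends : Fin k → Fin n × Fin n) a i j → (∀ e → ends e ≢ (i , j)) → weights ends a i j ≡ 0ℚ
  weights-none {zero}  ends a i j none = refl
  weights-none {suc k} ends a i j none = trans
    (cong₂ (λ w d → w + a zero * d) (weights-none (ends ∘ suc) (a ∘ suc) i j (none ∘ suc)) off)
    (trans (+-identityˡ _) (zeroʳ _))
    where
    off : δ i (proj₁ (ends zero)) * δ j (proj₂ (ends zero)) ≡ 0ℚ
    off with i Finₚ.≟ proj₁ (ends zero) | j Finₚ.≟ proj₂ (ends zero)
    ... | yes p | yes q = ⊥-elim (none zero (cong₂ _,_ (sym p) (sym q)))
    ... | yes p | no _  = zeroʳ _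
    ... | no _  | _     = zeroˡ _

  -- Simplicity makes each nonzero entry a single variable, so the initial matrix costs no gates.
  weights-edge : ∀ {k} (ends : Fin k → Fin n × Fin n) a {i j} → (∀ e e′ → ends e ≡ ends e′ → e ≡ e′) →
                 ∀ e → ends e ≡ (i , j) → weights ends a i j ≡ a e
  weights-edge ends a simple zero refl = trans
    (cong₂ (λ w d → w + a zero * d)
      (weights-none (ends ∘ suc) (a ∘ suc) _ _ λ e eq → 0≢1+ (simple (suc e) zero eq))
      (trans (cong₂ _*_ (δ-refl (proj₁ (ends zero))) (δ-refl (proj₂ (ends zero)))) (*-identityˡ _)))
    (trans (+-identityˡ _) (*-identityʳ _))
    where
    0≢1+ : ∀ {k} {e : Fin k} → suc e ≢ zero
    0≢1+ ()
  weights-edge ends a {i} {j} simple (suc e) eq = trans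
    (cong₂ (λ w d → w + a zero * d)
      (weights-edge (ends ∘ suc) (a ∘ suc) (λ e e′ eq → Finₚ.suc-injective (simple (suc e) (suc e′) eq)) e eq) off)
    (trans (cong (a (suc e) +_) (zeroʳ _)) (+-identityʳ _))
    where
    off : δ i (proj₁ (ends zero)) * δ j (proj₂ (ends zero)) ≡ 0ℚ
    off with i Finₚ.≟ proj₁ (ends zero) | j Finₚ.≟ proj₂ (ends zero)
    ... | yes p | yes q with () ← simple zero (suc e) (trans (cong₂ _,_ (sym p) (sym q)) (sym eq))
    off | yes p | no _  = zeroʳ _
    off | no _  | _     = zeroˡ _

  module _ {m : ℕ} (G : Digraph n) (r : Fin n) (reach : AllReach G r)
           (label : Fin (Digraph.edges G) → Fin m) where

    open Digraph G

    private
      empty : Program m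
      empty = record { code = [] ; noSub = [] ; positive = VecAll.[] }

      edge? : ∀ i j → Dec (∃ λ e → ends e ≡ (i , j))
      edge? i j = Finₚ.any? λ e → ×-≡-dec Finₚ._≟_ Finₚ._≟_ (ends e) (i , j)

      present : Fin n → Fin n → Bool
      present i j = does (edge? i j)

      W : Fin n → Fin n → Point m → ℚ
      W i j a = weights ends (valueAt a ∘ label) i j

      entry : ∀ i j → Entry empty (present i j) (W i j)
      entry i j with edge? i j
      ... | no ¬e        = λ a → weights-none ends (valueAt a ∘ label) i j (λ e eq → ¬e (e , eq))
      ... | yes (e , eq) = var (label e) , λ a → begin
        ι (eval (varᴾ (label e)) a)          ≡⟨ cong ι (eval-var (label e) a) ⟩
        valueAt a (label e)                  ≡⟨ sym (weights-edge ends (valueAt a ∘ label) simple e eq) ⟩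
        W i j a                              ≡⟨ sym (*-identityʳ _) ⟩
        W i j a * 1ℚ                         ≡⟨ cong (W i j a *_) (sym (trans (cong ι (eval-const ℤ.1ℤ a)) ι-1)) ⟩
        W i j a * ι (eval 1ᴾ a)              ∎

      linked : ∀ {v vs} → Walk (Arc G ⊤) v vs r → Linked r present (others r) v
      linked [] = stop
      linked (_∷_ {v = v} (e , _ , eq) p) = step member (dec-true (edge? _ v) (e , eq)) (linked p)
        where
        member : v ∈ r ∷ others r
        member with v Finₚ.≟ r
        ... | yes v≡r = here v≡r
        ... | no v≢r  = there (others-complete r v≢r)

    -- Serves both cases: `label` is the identity for a digraph and merges the two directions of an
    -- edge for a graph. Agreement with `p` is asked only at positive integer points, and
    -- `eval-injective` lifts it to polynomials.
    arborescence-circuit : (p : Poly m) → (∀ a → arb r (others r) (λ i j → W i j a) ≡ ι (eval p a)) →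
      ∃ λ (c : Circuit m) → SubtractionFree c × Computes c (fromPoly p) × size c ≤ 2 ℕ.* n ^ 3
    arborescence-circuit p eq with eliminate-all (others r) (others-unique r) {empty} W present
      (λ {i} {j} _ _ → entry i j) (λ {i} _ → linked (proj₂ (reach i)))
    ... | built Q bound _ (w , rep) =
      record { size = count Q ; gates = code Q ; output = w } ,
      noSub Q ,
      (VecAll.map (positive-nonzero ∘ proj₂) (positive Q) ,
       eval-injective (num q *ᴾ 1ᴾ) (p *ᴾ den q) λ a → begin
         eval (num q *ᴾ 1ᴾ) a                ≡⟨ eval-* (num q) 1ᴾ a ⟩
         eval (num q) a ℤ.* eval 1ᴾ a        ≡⟨ cong (eval (num q) a ℤ.*_) (eval-const ℤ.1ℤ a) ⟩
         eval (num q) a ℤ.* ℤ.1ℤ             ≡⟨ ℤₚ.*-identityʳ _ ⟩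
         eval (num q) a                      ≡⟨ ι-injective (trans (rep a) (trans
                                                  (cong (_* ι (eval (den q) a)) (eq a))
                                                  (sym (ι-* (eval p a) (eval (den q) a))))) ⟩
         eval p a ℤ.* eval (den q) a         ≡⟨ sym (eval-* p (den q) a) ⟩
         eval (p *ᴾ den q) a                 ∎) ,
      ℕₚ.≤-trans bound (ℕₚ.≤-trans (ℕₚ.≤-reflexive (ℕₚ.+-identityʳ _)) (ℕₚ.≤-trans (cost-bound (length (others r)))
        (ℕₚ.*-monoʳ-≤ 2 (ℕₚ.^-monoˡ-≤ 3 (unique-length (others-unique r))))))
      where q = valueOf Q w

digraph-circuit : ∀ n (G : Digraph n) (r : Fin n) → AllReach G r →
  ∃ λ (c : Circuit (Digraph.edges G)) →
    SubtractionFree c × Computes c (fromPoly (φ G r)) × size c ≤ 2 ℕ.* n ^ 3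
digraph-circuit n G r reach = arborescence-circuit G r reach id (φ G r) λ a →
  trans (directedTrees r G (valueAt a))
        (sym (eval-generating (isDirectedSpanningTree? G r) (allSubsets _) a))

graph-circuit : ∀ n (G : Graph n) → Connected G →
  ∃ λ (c : Circuit (Graph.edges G)) →
    SubtractionFree c × Computes c (fromPoly (f G)) × size c ≤ 2 ℕ.* n ^ 3
-- Any vertex could be the root; connectedness makes `zero` reachable from everywhere.
graph-circuit (suc n) G connected = arborescence-circuit bidirected zero reach edgeOf (f G) λ a →
  trans (bidirectedTrees zero (valueAt a))
        (sym (eval-generating (isSpanningTree? G) (allSubsets _) a))
  where
  open Bidirect G
  reach : AllReach bidirected zero
  reach v = let vs , p = connected v zero in vs , walk-map adj⇒arc p
graph-circuit zero record { edges = suc _ ; ends = ends } _ = ⊥-elim (Finₚ.¬Fin0 (proj₁ (ends zero)))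
-- Without vertices the empty edge set is vacuously a spanning tree, so the generating function is
-- 1. The bound allows no gates, and the output is the scalar 1.
graph-circuit zero G@record { edges = zero } _ =
  record { size = 0 ; gates = [] ; output = scalar 1 } , [] ,
  (VecAll.[] , eval-injective (1ᴾ *ᴾ 1ᴾ) (f G *ᴾ 1ᴾ) λ a → begin
    eval (1ᴾ *ᴾ 1ᴾ) a           ≡⟨ eval-* 1ᴾ 1ᴾ a ⟩
    eval 1ᴾ a ℤ.* eval 1ᴾ a     ≡⟨ cong (ℤ._* eval 1ᴾ a) (trans (eval-const ℤ.1ℤ a) (sym (one a))) ⟩
    eval (f G) a ℤ.* eval 1ᴾ a  ≡⟨ sym (eval-* (f G) 1ᴾ a) ⟩
    eval (f G *ᴾ 1ᴾ) a          ∎) ,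
  z≤n
  where
  one : ∀ a → eval (f G) a ≡ ℤ.1ℤ
  one a = ι-injective (begin
    ι (eval (f G) a)
      ≡⟨ eval-generating (isSpanningTree? G) (allSubsets 0) a ⟩
    χ (isSpanningTree? G []) * 1ℚ + 0ℚ
      ≡⟨ trans (+-identityʳ _) (*-identityʳ _) ⟩
    χ (isSpanningTree? G [])
      ≡⟨ χ-yes (isSpanningTree? G []) ((λ ()) , (λ ())) ⟩
    1ℚ
      ≡⟨ sym ι-1 ⟩
    ι ℤ.1ℤ ∎)

theorem2p8 : (∃ λ (C : ℕ) → ∀ (n : ℕ) (G : Graph n) → Connected G →
    ∃ λ (c : Circuit (Graph.edges G)) →
    SubtractionFree c × Computes c (fromPoly (f G)) × size c ≤ C ℕ.* n ^ 3)
    × (∃ λ (C : ℕ) → ∀ (n : ℕ) (G : Digraph n) (r : Fin n) → AllReach G r →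
    ∃ λ (c : Circuit (Digraph.edges G)) →
    SubtractionFree c × Computes c (fromPoly (φ G r)) × size c ≤ C ℕ.* n ^ 3)
theorem2p8 = (2 , graph-circuit) , (2 , digraph-circuit)
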